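{- For every integer $d\ge4$, there is a deterministic $n^{O(d)}$-time reduction from a 3SAT instance on $n$ variables to a system $\mathcal{B}$ of constant-free polynomial equations of degree at most $d$ over $\mathbb{F}_2$ in the $n+1$ variables $x_0,x_1,\dots,x_n$, such that: (YES) if the input formula is satisfiable, then $\mathcal{B}$ has a satisfying assignment $a\in\mathbb{F}_2^{n+1}$ with $a_0=1$; (NO) if the input formula is unsatisfiable and $\sigma$ is a monomial assignment of degree $d$ satisfying all equations in $\mathcal{B}$, then either $\beta_\sigma=\{\mathbf 0\}$ or $|\beta_\sigma|\ge 2^{d-3}$.
   Context: 3SAT is the problem of deciding satisfiability of a CNF formula whose clauses each have three literals. For $S\subseteq\{0,1,\dots,n\}$ write $x^S:=\prod_{i\in S}x_i$ (with $x^\emptyset=1$). Polynomials are multilinear over $\mathbb{F}_2$, i.e. taken modulo the relations $x_i^2=x_i$, so $x^Sx^T=x^{S\cup T}$. "Constant-free" means the polynomial has zero constant term; an equation is $p(x)=0$ for such a polynomial $p$. Let $\mathcal{U}_{n,d}:=\{S\subseteq\{0,1,\dots,n\}:1\le|S|\le d\}$. A monomial assignment of degree $d$ is a map $\sigma:\{x^S:S\in\mathcal{U}_{n,d}\}\to\mathbb{F}_2$; it is extended by setting $\sigma(1)=1$ and by linearity to all multilinear polynomials of degree at most $d$. $\sigma$ satisfies an equation $p=0$ if $\sigma(p)=0$. For every such $\sigma$ there exists a set $\beta\subseteq\mathbb{F}_2^{n+1}$ with $\sigma(q)=\sum_{a\in\beta}q(a)$ for every multilinear polynomial $q$ of degree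 at most $d$; $\beta_\sigma$ denotes a fixed such set of minimum cardinality. -}

module Defs where

open import Data.Bool using (Bool; true; false; _∧_; _xor_)
open import Data.Bool.Properties using () renaming (_≟_ to _≟ᵇ_)
open import Data.Fin using (Fin; toℕ)
open import Data.Fin.Subset using (Subset; ∣_∣) renaming (⊥ to ∅)
open import Data.List using (List; []; _∷_; map; foldr; length)
open import Data.List.Relation.Unary.All using (All)
open import Data.List.Relation.Unary.Unique.Propositional using (Unique)
open import Data.Nat using (ℕ; zero; suc; _+_; _≤_; _≤?_)
open import Data.Product using (Σ-syntax; ∃-syntax; _×_; _,_; proj₁)
open import Data.Vec using (Vec; []; _∷_; lookup; toList)
open import Data.Vec.Properties using (≡-dec)
open import Data.Vec.Relation.Unary.Any using (Any)
open import Relation.Binary.PropositionalEquality using (_≡_)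
open import Relation.Nullary using (does; yes; no)

------------------------------------------------------------------------
-- Model of computation.  A Turing-complete combinator language (in the
-- style of Backus' FP) on binary trees, with unbounded `while` loops.
-- The empty tree `leaf` is the truth value false, every other tree is true.

data Tree : Set where
  leaf : Tree
  _∙_  : Tree → Tree → Tree

infixr 5 _∙_

size : Tree → ℕ
size leaf    = 1
size (l ∙ r) = suc (size l + size r)

data Program : Set where
  id nil head tail : Program
  _⨾_              : Program → Program → Program
  ⟨_,_⟩            : Program → Program → Program
  if_then_else_    : Program → Program → Program → Program
  while_loop_      : Program → Program → Program

infixr 6 _⨾_

infix 4 _∶_⇓_[_]

-- p ∶ v ⇓ w [ t ] : on input v, program p halts with output w in time t.
-- `f ⨾ g` runs f first.  The rules are syntax-directed, hence deterministic.
-- Primitives are charged the size of the tree they read, so t is at least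
-- the size of every tree occurring in the computation, output included.
-- No sharing is free, and time agrees with Turing machine time up to a
-- fixed polynomial.
data _∶_⇓_[_] : Program → Tree → Tree → ℕ → Set where

  id-run     : ∀ {v} → id ∶ v ⇓ v [ size v ]

  nil-run    : ∀ {v} → nil ∶ v ⇓ leaf [ size v ]

  head-leaf  : head ∶ leaf ⇓ leaf [ 1 ]

  head-node  : ∀ {l r} → head ∶ l ∙ r ⇓ l [ size (l ∙ r) ]

  tail-leaf  : tail ∶ leaf ⇓ leaf [ 1 ]

  tail-node  : ∀ {l r} → tail ∶ l ∙ r ⇓ r [ size (l ∙ r) ]

  seq-run    : ∀ {f g u v w s t} →
               f ∶ u ⇓ v [ s ] → g ∶ v ⇓ w [ t ] →
               f ⨾ g ∶ u ⇓ w [ s + t ]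

  pair-run   : ∀ {f g u v w s t} →
               f ∶ u ⇓ v [ s ] → g ∶ u ⇓ w [ t ] →
               ⟨ f , g ⟩ ∶ u ⇓ v ∙ w [ suc (s + t) ]

  if-true    : ∀ {b f g v l r w s t} →
               b ∶ v ⇓ l ∙ r [ s ] → f ∶ v ⇓ w [ t ] →
               if b then f else g ∶ v ⇓ w [ suc (s + t) ]

  if-false   : ∀ {b f g v w s t} →
               b ∶ v ⇓ leaf [ s ] → g ∶ v ⇓ w [ t ] →
               if b then f else g ∶ v ⇓ w [ suc (s + t) ]

  while-stop : ∀ {b f v s} →
               b ∶ v ⇓ leaf [ s ] →
               while b loop f ∶ v ⇓ v [ suc s ]

  while-step : ∀ {b f u v w l r s t t′} →
               b ∶ u ⇓ l ∙ r [ s ] → f ∶ u ⇓ v [ t ] →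
               while b loop f ∶ v ⇓ w [ t′ ] →
               while b loop f ∶ u ⇓ w [ suc (s + t + t′) ]

encodeBool : Bool → Tree
encodeBool false = leaf
encodeBool true  = leaf ∙ leaf

-- Unary, so that encodings have size polynomial in the number of variables.
encodeℕ : ℕ → Tree
encodeℕ zero    = leaf
encodeℕ (suc n) = leaf ∙ encodeℕ n

encodeList : ∀ {A : Set} → (A → Tree) → List A → Tree
encodeList enc []       = leaf
encodeList enc (x ∷ xs) = enc x ∙ encodeList enc xs

------------------------------------------------------------------------
-- 3SAT

-- (true , i) is the positive literal of the variable i, (false , i) the
-- negated one.
Literal : ℕ → Set
Literal n = Bool × Fin n

Clause : ℕ → Set
Clause n = Vec (Literal n) 3

-- A CNF formula is a set of clauses: a clause is not listed twice, so an
-- instance has at most (2n)³ clauses and its size is polynomial in n.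
record 3CNF (n : ℕ) : Set where
  constructor mk3CNF
  field
    clauses  : List (Clause n)
    distinct : Unique clauses

open 3CNF public

LiteralTrue : ∀ {n} → Vec Bool n → Literal n → Set
LiteralTrue v (b , i) = lookup v i ≡ b

Satisfiable : ∀ {n} → 3CNF n → Set
Satisfiable {n} φ =
  ∃[ v ] All (λ C → Any (LiteralTrue {n} v) C) (clauses φ)

encodeLiteral : ∀ {n} → Literal n → Tree
encodeLiteral (b , i) = encodeBool b ∙ encodeℕ (toℕ i)

encodeClause : ∀ {n} → Clause n → Tree
encodeClause C = encodeList encodeLiteral (toList C)

encode3CNF : ∀ {n} → 3CNF n → Tree
encode3CNF {n} φ = encodeℕ n ∙ encodeList encodeClause (clauses φ)

------------------------------------------------------------------------
-- Multilinear polynomials over 𝔽₂ in x₀ , x₁ , … , xₙ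

-- Addition is _xor_ and multiplication is _∧_.
𝔽₂ : Set
𝔽₂ = Bool

∑ : List 𝔽₂ → 𝔽₂
∑ = foldr _xor_ false

Point : ℕ → Set
Point n = Vec 𝔽₂ (suc n)

-- monomial S a is the value of x^S at the point a.
monomial : ∀ {m} → Subset m → Vec 𝔽₂ m → 𝔽₂
monomial []          []      = true
monomial (true  ∷ S) (b ∷ a) = b ∧ monomial S a
monomial (false ∷ S) (b ∷ a) = monomial S a

-- The list S₁ , … , S_k stands for the polynomial x^S₁ + … + x^S_k; a
-- monomial listed twice cancels.
Poly : ℕ → ℕ → Set
Poly n d = List (Σ[ S ∈ Subset (suc n) ] ∣ S ∣ ≤ d)

eval : ∀ {n d} → Poly n d → Point n → 𝔽₂
eval p a = ∑ (map (λ m → monomial (proj₁ m) a) p)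

coefficient : ∀ {n d} → Poly n d → Subset (suc n) → 𝔽₂
coefficient p T = ∑ (map (λ m → does (≡-dec _≟ᵇ_ (proj₁ m) T)) p)

ConstantFree : ∀ {n d} → Poly n d → Set
ConstantFree p = coefficient p ∅ ≡ false

-- The polynomial p stands for the equation p = 0.
System : ℕ → ℕ → Set
System n d = List (Poly n d)

Solves : ∀ {n d} → Point n → System n d → Set
Solves a B = All (λ p → eval p a ≡ false) B

-- A monomial x^S is written as the bit vector of S.
encodePoly : ∀ {n d} → Poly n d → Tree
encodePoly = encodeList (λ m → encodeList encodeBool (toList (proj₁ m)))

encodeSystem : ∀ {n d} → System n d → Tree
encodeSystem = encodeList encodePoly

------------------------------------------------------------------------
-- Monomial assignments

𝒰 : ℕ → ℕ → Set
𝒰 n d = Σ[ S ∈ Subset (suc n) ] (1 ≤ ∣ S ∣ × ∣ S ∣ ≤ d)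

MonomialAssignment : ℕ → ℕ → Set
MonomialAssignment n d = 𝒰 n d → 𝔽₂

extendMonomial : ∀ {n d} → MonomialAssignment n d →
                 Σ[ S ∈ Subset (suc n) ] ∣ S ∣ ≤ d → 𝔽₂
extendMonomial σ (S , S≤d) with 1 ≤? ∣ S ∣
... | yes 1≤S = σ (S , 1≤S , S≤d)
... | no  _   = true

extend : ∀ {n d} → MonomialAssignment n d → Poly n d → 𝔽₂
extend σ p = ∑ (map (extendMonomial σ) p)

SatisfiesAll : ∀ {n d} → MonomialAssignment n d → System n d → Set
SatisfiesAll σ B = All (λ p → extend σ p ≡ false) B

-- Finite sets of points are duplicate-free lists.
Represents : ∀ {n d} → MonomialAssignment n d → List (Point n) → Set
Represents {n} {d} σ β =
  Unique β × (∀ (q : Poly n d) → extend σ q ≡ ∑ (map (eval q) β))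

-- β is a possible choice of β_σ.
IsMinimumRepresentation : ∀ {n d} →
  MonomialAssignment n d → List (Point n) → Set
IsMinimumRepresentation σ β =
  Represents σ β × (∀ β′ → Represents σ β′ → length β ≤ length β′)

{-# OPTIONS --safe #-}

-- The system consists of the multiples of degree ≤ d of x₀ · ∏ (falsity of l), over
-- the literals l of a clause, and of (1 + x₀) · xᵢ.  If φ is unsatisfiable, every point
-- a ≠ 0 is a non-zero of one of these base polynomials p: if a₀ = 1 then a violates a
-- clause, and if a₀ = 0 then some aᵢ = 1.  When β contains such a point, the points
-- of β with p = 1 form a non-empty set orthogonal to all polynomials of degree
-- ≤ d - 4, a non-zero word of the dual of a Reed–Muller code, and hence number
-- at least 2^(d-3).  Otherwise β ⊆ {0}, and β is not empty because σ(1) = 1.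
--
-- The program multiplies the base system d - 4 times by the variables.  A
-- multiplication costs a fixed power of the size of the current system, and enlarges
-- that size by a factor of at most (2 + n)², which gives an exponent linear in d.

module Submission where

open import Defs
open import Data.Bool using (Bool; true; false; _∧_; _xor_)
open import Data.Bool.Properties
  using (∧-assoc; ∧-zeroʳ; ∧-identityʳ; ∧-distribˡ-xor;
         xor-assoc; xor-comm; xor-same; xor-identityʳ; ¬-not)
  renaming (_≟_ to _≟ᵇ_)
open import Data.Fin using (Fin; zero; suc; toℕ; fromℕ<; combine)
open import Data.Fin.Properties using (toℕ-fromℕ<; toℕ<n; fromℕ<-toℕ; combine-injective; injective⇒≤)
open import Data.Fin.Subset using (Subset; ∣_∣) renaming (⊥ to ∅)
import Data.List as List
open import Data.List using (List; []; _∷_; map; _ʳ++_; length; filter)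
open import Data.List.Membership.Propositional using (_∈_; find; lose)
open import Data.List.Membership.Propositional.Properties using (∈-filter⁺; ∈-lookup)
open import Data.List.Properties using (length-filter)
open import Data.List.Relation.Unary.All as All using (All; []; _∷_)
open import Data.List.Relation.Unary.AllPairs using ([]; _∷_)
open import Data.List.Relation.Unary.Any using (any?; here; there)
open import Data.List.Relation.Unary.Unique.Propositional using (Unique)
import Data.List.Relation.Unary.Unique.Propositional.Properties as Unique
open import Data.Nat using (ℕ; zero; suc; _+_; _*_; _∸_; _^_; _≤_; _<_; _≤?_; z≤n; s≤s)
open import Data.Nat.Properties
open import Data.Nat.Solver using (module +-*-Solver)
open import Data.Product using (Σ-syntax; ∃-syntax; _×_; _,_; proj₁; proj₂)
open import Data.Sum using (_⊎_; inj₁; inj₂)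
open import Data.Unit using (⊤; tt)
open import Data.Vec using (Vec; []; _∷_; _[_]≔_; toList; lookup; replicate)
open import Data.Vec.Properties using (≡-dec)
open import Data.Vec.Relation.Unary.Any as VecAny using (here; there)
open import Function using (_∘_; Injective)
open import Relation.Binary.PropositionalEquality
  using (_≡_; _≢_; refl; sym; trans; cong; cong₂; subst; module ≡-Reasoning)
open import Relation.Nullary using (¬_; yes; no; contradiction)

open +-*-Solver using (solve; _:=_; _:+_; _:*_; con)

-- Polynomial bounds

-- The base `2 + s` is at least 2 even for `s = 0`, so constants and sums are absorbed by raising
-- the exponent.
record PolyBounded (h : ℕ → ℕ) : Set where
  constructor _,_
  field
    exponent : ℕ
    bound    : ∀ s → h s ≤ (2 + s) ^ exponent

^-exponent-≤ : ∀ s {j k} → j ≤ k → (2 + s) ^ j ≤ (2 + s) ^ k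
^-exponent-≤ s = ^-monoʳ-≤ (2 + s)

^-base-≤ : ∀ {s t} k → s ≤ t → (2 + s) ^ k ≤ (2 + t) ^ k
^-base-≤ k s≤t = ^-monoˡ-≤ k (+-monoʳ-≤ 2 s≤t)

1≤^ : ∀ s k → 1 ≤ (2 + s) ^ k
1≤^ s = m^n>0 (2 + s)

double-^ : ∀ s {x y} k → x ≤ (2 + s) ^ k → y ≤ (2 + s) ^ k → x + y ≤ (2 + s) ^ suc k
double-^ s {x} {y} k x≤ y≤ = begin
  x + y                    ≤⟨ +-mono-≤ x≤ y≤ ⟩
  (2 + s) ^ k + (2 + s) ^ k ≡⟨ cong ((2 + s) ^ k +_) (sym (+-identityʳ _)) ⟩
  2 * (2 + s) ^ k          ≤⟨ *-monoˡ-≤ ((2 + s) ^ k) (m≤m+n 2 s) ⟩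
  (2 + s) ^ suc k          ∎
  where open ≤-Reasoning

1-poly : PolyBounded (λ _ → 1)
1-poly = 0 , λ _ → ≤-refl

id-poly : PolyBounded (λ s → s)
id-poly = 1 , λ s → ≤-trans (m≤n+m s 2) (≤-reflexive (sym (*-identityʳ (2 + s))))

+-poly : ∀ {g h} → PolyBounded g → PolyBounded h → PolyBounded (λ s → g s + h s)
+-poly (j , g≤) (k , h≤) = suc (j + k) , λ s →
  double-^ s (j + k) (≤-trans (g≤ s) (^-exponent-≤ s (m≤m+n j k)))
                     (≤-trans (h≤ s) (^-exponent-≤ s (m≤n+m k j)))

*-poly : ∀ {g h} → PolyBounded g → PolyBounded h → PolyBounded (λ s → g s * h s)
*-poly (j , g≤) (k , h≤) = j + k , λ s →
  ≤-trans (*-mono-≤ (g≤ s) (h≤ s)) (≤-reflexive (sym (^-distribˡ-+-* (2 + s) j k)))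

-- Beyond `j`, one unit of exponent makes room for the 2 and another for the sum, hence `2 + j`.
^-compose : ∀ s {x} j k → x ≤ (2 + s) ^ j → (2 + x) ^ k ≤ (2 + s) ^ ((2 + j) * k)
^-compose s {x} j k x≤ = begin
  (2 + x) ^ k            ≤⟨ ^-monoˡ-≤ k 2+x≤ ⟩
  ((2 + s) ^ (2 + j)) ^ k ≡⟨ ^-*-assoc (2 + s) (2 + j) k ⟩
  (2 + s) ^ ((2 + j) * k) ∎
  where
  open ≤-Reasoning
  2≤ : 2 ≤ (2 + s) ^ suc j
  2≤ = ≤-trans (m≤m+n 2 s) (m≤m*n (2 + s) ((2 + s) ^ j) {{m^n≢0 (2 + s) j}})
  2+x≤ : 2 + x ≤ (2 + s) ^ (2 + j)
  2+x≤ = double-^ s (suc j) 2≤ (≤-trans x≤ (^-exponent-≤ s (n≤1+n j)))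

^-poly : ∀ {h} → PolyBounded h → ∀ k → PolyBounded (λ s → (2 + h s) ^ k)
^-poly (j , h≤) k = (2 + j) * k , λ s → ^-compose s j k (h≤ s)

power-poly : ∀ k → PolyBounded (λ s → (2 + s) ^ k)
power-poly k = k , λ _ → ≤-refl

-- Polynomial-time tree functions

Halts : Program → Tree → Tree → ℕ → Set
Halts p v w T = Σ[ t ∈ ℕ ] (p ∶ v ⇓ w [ t ] × t ≤ T)

Halts-cong : ∀ {p v w w′ T} → Halts p v w T → w ≡ w′ → Halts p v w′ T
Halts-cong h refl = h

1≤size : ∀ v → 1 ≤ size v
1≤size leaf    = ≤-refl
1≤size (_ ∙ _) = s≤s z≤n

size-∙-monoʳ : ∀ e l l′ → size l ≤ size l′ → size (e ∙ l) ≤ size (e ∙ l′)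
size-∙-monoʳ e _ _ l≤l′ = s≤s (+-monoʳ-≤ (size e) l≤l′)

size-left : ∀ x l → size x ≤ size (x ∙ l)
size-left x l = m≤n⇒m≤1+n (m≤m+n (size x) (size l))

size-right : ∀ x l → size l ≤ size (x ∙ l)
size-right x l = m≤n⇒m≤1+n (m≤n+m (size l) (size x))

input≤time : ∀ {p v w t} → p ∶ v ⇓ w [ t ] → size v ≤ t
input≤time id-run    = ≤-refl
input≤time nil-run   = ≤-refl
input≤time head-leaf = ≤-refl
input≤time head-node = ≤-refl
input≤time tail-leaf = ≤-refl
input≤time tail-node = ≤-refl
input≤time (seq-run r _)        = m≤n⇒m≤n+o _ (input≤time r)
input≤time (pair-run r _)       = m≤n⇒m≤1+n (m≤n⇒m≤n+o _ (input≤time r))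
input≤time (if-true r _)        = m≤n⇒m≤1+n (m≤n⇒m≤n+o _ (input≤time r))
input≤time (if-false r _)       = m≤n⇒m≤1+n (m≤n⇒m≤n+o _ (input≤time r))
input≤time (while-stop r)       = m≤n⇒m≤1+n (input≤time r)
input≤time (while-step r _ _)   = m≤n⇒m≤1+n (m≤n⇒m≤n+o _ (m≤n⇒m≤n+o _ (input≤time r)))

-- Time bounds thereby serve as size bounds: `PolyTime` carries no separate bound on the output, and
-- composition relies on this.
output≤time : ∀ {p v w t} → p ∶ v ⇓ w [ t ] → size w ≤ t
output≤time id-run                  = ≤-refl
output≤time (nil-run {v})           = 1≤size v
output≤time head-leaf               = ≤-refl
output≤time (head-node {l} {r})     = m≤n⇒m≤1+n (m≤m+n (size l) (size r))
output≤time tail-leaf               = ≤-refl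
output≤time (tail-node {l} {r})     = m≤n⇒m≤1+n (m≤n+m (size r) (size l))
output≤time (seq-run {s = s} _ r)   = m≤n⇒m≤o+n s (output≤time r)
output≤time (pair-run r r′)         = s≤s (+-mono-≤ (output≤time r) (output≤time r′))
output≤time (if-true {s = s} _ r)   = m≤n⇒m≤1+n (m≤n⇒m≤o+n s (output≤time r))
output≤time (if-false {s = s} _ r)  = m≤n⇒m≤1+n (m≤n⇒m≤o+n s (output≤time r))
output≤time (while-stop r)          = m≤n⇒m≤1+n (input≤time r)
output≤time (while-step {s = s} {t = t} _ _ r) = m≤n⇒m≤1+n (m≤n⇒m≤o+n (s + t) (output≤time r))

-- The bound is on all trees, also those that encode nothing, so the combinators compose without
-- side conditions.
record PolyTime (f : Tree → Tree) : Set where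
  constructor polyTime
  field
    program : Program
    degree  : ℕ
    runs    : ∀ v → Halts program v (f v) ((2 + size v) ^ degree)

open PolyBounded
open PolyTime

fromBound : ∀ {f h} p → PolyBounded h → (∀ v → Halts p v (f v) (h (size v))) → PolyTime f
fromBound p (k , h≤) run = polyTime p k λ v →
  let (t , r , t≤) = run v in t , r , ≤-trans t≤ (h≤ (size v))

PolyTime-cong : ∀ {f g} → PolyTime f → (∀ v → f v ≡ g v) → PolyTime g
PolyTime-cong (polyTime p k run) f≗g = polyTime p k λ v → Halts-cong (run v) (f≗g v)

hd tl : Tree → Tree
hd leaf    = leaf
hd (l ∙ _) = l
tl leaf    = leaf
tl (_ ∙ r) = r

branch : Tree → Tree → Tree → Tree
branch leaf    x y = y
branch (_ ∙ _) x y = x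

opaque
  leafP : PolyTime (λ _ → leaf)
  leafP = fromBound nil id-poly λ v → size v , nil-run , ≤-refl

  hdP : PolyTime hd
  hdP = fromBound head id-poly λ where
    leaf    → 1 , head-leaf , ≤-refl
    (l ∙ r) → size (l ∙ r) , head-node , ≤-refl

  tlP : PolyTime tl
  tlP = fromBound tail id-poly λ where
    leaf    → 1 , tail-leaf , ≤-refl
    (l ∙ r) → size (l ∙ r) , tail-node , ≤-refl

infixr 6 _⨾P_
infixr 5 _∙P_

opaque
  _⨾P_ : ∀ {f g} → PolyTime f → PolyTime g → PolyTime (λ v → g (f v))
  _⨾P_ {f} F G = fromBound (program F ⨾ program G)
    (+-poly (power-poly (degree F)) (^-poly (power-poly (degree F)) (degree G)))
    λ v → let (s , r , s≤)  = runs F v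
              (t , r′ , t≤) = runs G (f v)
              w≤            = ≤-trans (output≤time r) s≤
          in s + t , seq-run r r′ ,
             +-mono-≤ s≤ (≤-trans t≤ (^-base-≤ (degree G) w≤))

  _∙P_ : ∀ {f g} → PolyTime f → PolyTime g → PolyTime (λ v → f v ∙ g v)
  F ∙P G = fromBound ⟨ program F , program G ⟩
    (+-poly 1-poly (+-poly (power-poly (degree F)) (power-poly (degree G))))
    λ v → let (s , r , s≤)  = runs F v
              (t , r′ , t≤) = runs G v
          in suc (s + t) , pair-run r r′ , s≤s (+-mono-≤ s≤ t≤)

  branchP : ∀ {b f g} → PolyTime b → PolyTime f → PolyTime g →
            PolyTime (λ v → branch (b v) (f v) (g v))
  branchP {b} {f} {g} B F G = fromBound (if program B then program F else program G)
    (+-poly 1-poly (+-poly (power-poly (degree B)) (+-poly (power-poly (degree F)) (power-poly (degree G)))))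
    run
    where
    run : ∀ v → Halts (if program B then program F else program G) v (branch (b v) (f v) (g v))
      (1 + ((2 + size v) ^ degree B + ((2 + size v) ^ degree F + (2 + size v) ^ degree G)))
    run v with b v | runs B v
    ... | leaf | s , r , s≤ = let (t , r′ , t≤) = runs G v in
      suc (s + t) , if-false r r′ , s≤s (+-mono-≤ s≤ (m≤n⇒m≤o+n _ t≤))
    ... | _ ∙ _ | s , r , s≤ = let (t , r′ , t≤) = runs F v in
      suc (s + t) , if-true r r′ , s≤s (+-mono-≤ s≤ (m≤n⇒m≤n+o _ t≤))

-- A tree is read as the list of its left subtrees along the right spine.  F
-- sees the fixed environment e and the whole remaining list, not only its first entry.
foldTree : (Tree → Tree) → Tree → Tree → Tree → Tree
foldTree F e leaf    a = a
foldTree F e (x ∙ l) a = foldTree F e l (F (e ∙ (x ∙ l) ∙ a))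

-- The growth of the accumulator must not depend on the accumulator itself:
-- this keeps it polynomial over the whole loop.
Additive : (Tree → Tree) → ℕ → Set
Additive F g = ∀ e x l a → size (F (e ∙ (x ∙ l) ∙ a)) ≤ size a + (2 + size (e ∙ x ∙ l)) ^ g

-- The bound `X` for the first step serves for all later ones, since the list only shrinks; there
-- are fewer than `size l` steps.
foldTree-size : ∀ {F g X} → Additive F g → ∀ e l a → (2 + size (e ∙ l)) ^ g ≤ X →
                size (foldTree F e l a) ≤ size a + size l * X
foldTree-size add e leaf a X≥ = m≤m+n (size a) _
foldTree-size {F} {g} {X} add e (x ∙ l) a X≥ = begin
  size (foldTree F e l (F (e ∙ (x ∙ l) ∙ a)))
    ≤⟨ foldTree-size {g = g} add e l _ (≤-trans (^-base-≤ g (size-∙-monoʳ e l (x ∙ l) (size-right x l))) X≥) ⟩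
  size (F (e ∙ (x ∙ l) ∙ a)) + size l * X
    ≤⟨ +-monoˡ-≤ _ (≤-trans (add e x l a) (+-monoʳ-≤ (size a) X≥)) ⟩
  size a + X + size l * X
    ≡⟨ +-assoc (size a) X _ ⟩
  size a + suc (size l) * X
    ≤⟨ +-monoʳ-≤ (size a) (*-monoˡ-≤ X (s≤s (m≤n+m (size l) (size x)))) ⟩
  size a + size (x ∙ l) * X ∎
  where open ≤-Reasoning

module _ {F : Tree → Tree} {g : ℕ} (add : Additive F g)
         (test : PolyTime (λ v → hd (tl v)))
         (body : PolyTime (λ v → hd v ∙ tl (hd (tl v)) ∙ F v)) where

  private
    loop : Program
    loop = while program test loop program body

    round : ℕ → ℕ
    round M = 1 + ((2 + M) ^ degree test + (2 + M) ^ degree body)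

    -- The potential `size (e ∙ l ∙ a) + size l * X` never increases along the loop, as each step
    -- adds at most `X` to the accumulator. So `M` bounds every state, and each round costs at most
    -- `round M`.
    loop-runs : ∀ e l a {X M} → (2 + size (e ∙ l)) ^ g ≤ X →
                size (e ∙ l ∙ a) + size l * X ≤ M →
                Halts loop (e ∙ l ∙ a) (e ∙ leaf ∙ foldTree F e l a) (size l * round M)
    loop-runs e leaf a {X} {M} X≥ M≥ with runs test (e ∙ leaf ∙ a)
    ... | s , r , s≤ = suc s , while-stop r ,
      ≤-trans (s≤s (≤-trans (≤-trans s≤ (^-base-≤ (degree test) (m+n≤o⇒m≤o _ M≥))) (m≤m+n _ _)))
              (≤-reflexive (sym (+-identityʳ _)))
    loop-runs e (x ∙ l) a {X} {M} X≥ M≥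
      with runs test (e ∙ (x ∙ l) ∙ a) | runs body (e ∙ (x ∙ l) ∙ a)
         | loop-runs e l (F (e ∙ (x ∙ l) ∙ a)) {X} {M}
             (≤-trans (^-base-≤ g (size-∙-monoʳ e l (x ∙ l) (size-right x l))) X≥)
             M≥′
      where
      open ≤-Reasoning
      M≥′ : size (e ∙ l ∙ F (e ∙ (x ∙ l) ∙ a)) + size l * X ≤ M
      M≥′ = begin
        suc (size e + suc (size l + size (F (e ∙ (x ∙ l) ∙ a)))) + size l * X
          ≤⟨ +-monoˡ-≤ (size l * X) (s≤s (+-monoʳ-≤ (size e) (s≤s (+-monoʳ-≤ (size l)
               (≤-trans (add e x l a) (+-monoʳ-≤ (size a) X≥)))))) ⟩
        suc (size e + suc (size l + (size a + X))) + size l * X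
          -- The added term is exactly the drop of the potential when `x` and its node leave the
          -- list and the accumulator gains `X`.
          ≤⟨ m≤m+n _ (suc (size x) + size x * X) ⟩
        suc (size e + suc (size l + (size a + X))) + size l * X + (suc (size x) + size x * X)
          ≡⟨ solve 5 (λ e l a x X →
               con 1 :+ (e :+ (con 1 :+ (l :+ (a :+ X)))) :+ l :* X :+ (con 1 :+ x :+ x :* X)
               := con 1 :+ (e :+ (con 1 :+ (con 1 :+ (x :+ l) :+ a))) :+ (con 1 :+ (x :+ l)) :* X)
               refl (size e) (size l) (size a) (size x) X ⟩
        size (e ∙ (x ∙ l) ∙ a) + size (x ∙ l) * X
          ≤⟨ M≥ ⟩
        M ∎
    ... | s , r , s≤ | t , r′ , t≤ | u , r″ , u≤ =
      suc (s + t + u) , while-step r r′ r″ ,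
      ≤-trans (+-mono-≤ (s≤s (+-mono-≤ (enlarge (degree test) s≤) (enlarge (degree body) t≤))) u≤)
              (*-monoˡ-≤ (round M) (s≤s (m≤n+m (size l) (size x))))
      where
      enlarge : ∀ {y} k → y ≤ (2 + size (e ∙ (x ∙ l) ∙ a)) ^ k → y ≤ (2 + M) ^ k
      enlarge k y≤ = ≤-trans y≤ (^-base-≤ k (m+n≤o⇒m≤o _ M≥))

    M₀ : ℕ → ℕ
    M₀ s = s + s * (2 + s) ^ g

    M₀-poly : PolyBounded M₀
    M₀-poly = +-poly id-poly (*-poly id-poly (power-poly g))

    round-poly : PolyBounded (λ s → s * round (M₀ s))
    round-poly = *-poly id-poly (+-poly 1-poly
      (+-poly (^-poly M₀-poly (degree test)) (^-poly M₀-poly (degree body))))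

    -- Trees too short to be a state stop the loop at once and are returned as they are, not rebuilt
    -- as triples. Taking `tl` twice makes all cases agree with the fold.
    loop-result : Tree → Tree
    loop-result leaf                = leaf
    loop-result (e ∙ leaf)          = e ∙ leaf
    loop-result (e ∙ l ∙ a)         = e ∙ leaf ∙ foldTree F e l a

    loop-halts : ∀ e l a → Halts loop (e ∙ l ∙ a) (e ∙ leaf ∙ foldTree F e l a)
      (1 + (2 + size (e ∙ l ∙ a)) ^ degree test + size (e ∙ l ∙ a) * round (M₀ (size (e ∙ l ∙ a))))
    loop-halts e l a =
      let (t , r , t≤) = loop-runs e l a X≥ M≥
      in t , r , ≤-trans t≤ (m≤n⇒m≤o+n (1 + (2 + s) ^ degree test) (*-monoˡ-≤ (round (M₀ s)) l≤))
      where
      s = size (e ∙ l ∙ a)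
      l≤ : size l ≤ s
      l≤ = ≤-trans (size-left l a) (size-right e (l ∙ a))
      X≥ : (2 + size (e ∙ l)) ^ g ≤ (2 + s) ^ g
      X≥ = ^-base-≤ g (size-∙-monoʳ e l (l ∙ a) (size-left l a))
      M≥ : s + size l * (2 + s) ^ g ≤ M₀ s
      M≥ = +-monoʳ-≤ s (*-monoˡ-≤ ((2 + s) ^ g) l≤)

    loopP : PolyTime loop-result
    loopP = fromBound loop
      (+-poly (+-poly 1-poly (power-poly (degree test))) round-poly) run
      where
      run : ∀ v → Halts loop v (loop-result v)
                    (1 + (2 + size v) ^ degree test + size v * round (M₀ (size v)))
      run leaf       = let (s , r , s≤) = runs test leaf in
        suc s , while-stop r , m≤n⇒m≤n+o _ (s≤s s≤)
      run (e ∙ leaf) = let (s , r , s≤) = runs test (e ∙ leaf) in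
        suc s , while-stop r , m≤n⇒m≤n+o _ (s≤s s≤)
      run (e ∙ leaf ∙ a)    = loop-halts e leaf a
      run (e ∙ (x ∙ l) ∙ a) = loop-halts e (x ∙ l) a

  foldLoopP : PolyTime (λ v → foldTree F (hd v) (hd (tl v)) (tl (tl v)))
  foldLoopP = PolyTime-cong (loopP ⨾P tlP ⨾P tlP) λ where
    leaf                → refl
    (e ∙ leaf)          → refl
    (e ∙ leaf ∙ a)      → refl
    (e ∙ (x ∙ l) ∙ a)   → refl

opaque
  foldP : ∀ {F g} → PolyTime F → Additive F g →
          PolyTime (λ v → foldTree F (hd v) (hd (tl v)) (tl (tl v)))
  foldP {g = g} P add = foldLoopP {g = g} add (tlP ⨾P hdP) (hdP ∙P (tlP ⨾P hdP ⨾P tlP) ∙P P)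

-- The tree functions of the reduction

mapStep : (Tree → Tree) → Tree → Tree
mapStep f u = f (hd u ∙ hd (hd (tl u))) ∙ tl (tl u)

mapOnto : (Tree → Tree) → Tree → Tree → Tree → Tree
mapOnto f = foldTree (mapStep f)

-- Only `e` and `x` are passed to `f`, so the size of its output, bounded by its running time, does
-- not involve the accumulator.
mapStep-additive : ∀ {f} (P : PolyTime f) → Additive (mapStep f) (suc (degree P))
mapStep-additive {f} P e x l a = begin
  suc (size (f (e ∙ x)) + size a) ≡⟨ +-comm (suc (size (f (e ∙ x)))) (size a) ⟩
  size a + suc (size (f (e ∙ x))) ≤⟨ +-monoʳ-≤ (size a) (double-^ s (degree P) (1≤^ s (degree P)) f≤) ⟩
  size a + (2 + s) ^ suc (degree P) ∎
  where
  open ≤-Reasoning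
  s = size (e ∙ x ∙ l)
  f≤ : size (f (e ∙ x)) ≤ (2 + s) ^ degree P
  f≤ = let (_ , r , t≤) = runs P (e ∙ x) in
    ≤-trans (output≤time r) (≤-trans t≤ (^-base-≤ (degree P) (size-∙-monoʳ e x (x ∙ l) (size-left x l))))

opaque
  mapOntoP : ∀ {f} → PolyTime f → PolyTime (λ v → mapOnto f (hd v) (hd (tl v)) (tl (tl v)))
  mapOntoP P = foldP {g = suc (degree P)} (((hdP ∙P (tlP ⨾P hdP ⨾P hdP)) ⨾P P) ∙P (tlP ⨾P tlP))
                  (mapStep-additive P)

-- Pushing onto the accumulator reverses the list, hence `_ʳ++_`. Order matters neither in a
-- polynomial nor in a system, so nothing is reversed back.
mapOnto-encode : ∀ {A B : Set} {enc : A → Tree} {enc′ : B → Tree} {f e} (h : A → B) →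
                 (∀ x → f (e ∙ enc x) ≡ enc′ (h x)) → ∀ xs ys →
                 mapOnto f e (encodeList enc xs) (encodeList enc′ ys) ≡ encodeList enc′ (map h xs ʳ++ ys)
mapOnto-encode h f≗h []       ys = refl
mapOnto-encode {enc = enc} {enc′} {f} {e} h f≗h (x ∷ xs) ys =
  trans (cong (λ w → mapOnto f e (encodeList enc xs) (w ∙ encodeList enc′ ys)) (f≗h x))
        (mapOnto-encode {f = f} h f≗h xs (h x ∷ ys))

-- The accumulator is a zipper: the reversed prefix of a bit vector, and the rest.
shift : Tree → Tree
shift u = (hd (tl (tl (tl u))) ∙ hd (tl (tl u))) ∙ tl (tl (tl (tl u)))

opaque
  shiftP : PolyTime shift
  shiftP = ((tlP ⨾P tlP ⨾P tlP ⨾P hdP) ∙P (tlP ⨾P tlP ⨾P hdP)) ∙P (tlP ⨾P tlP ⨾P tlP ⨾P tlP)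

shift-additive : Additive shift 1
shift-additive e x l a = begin
  size (shift (e ∙ (x ∙ l) ∙ a))     ≤⟨ grow a ⟩
  size a + 4
    ≤⟨ +-monoʳ-≤ (size a) (+-monoʳ-≤ 3 (≤-trans (1≤size e) (m≤m+n (size e) _))) ⟩
  size a + (2 + size (e ∙ x ∙ l))    ≡⟨ cong (size a +_) (sym (*-identityʳ _)) ⟩
  size a + (2 + size (e ∙ x ∙ l)) ^ 1 ∎
  where
  open ≤-Reasoning
  grow : ∀ a → size (shift (e ∙ (x ∙ l) ∙ a)) ≤ size a + 4
  -- The worst case: on an accumulator that is no zipper, the default values of `hd` and `tl` build
  -- four new nodes. A genuine shift preserves the size.
  grow leaf = ≤-refl
  grow (p ∙ leaf) = s≤s (≤-trans (m≤n+m _ 2) (≤-reflexive (+-comm 4 (size p + 1))))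
  grow (p ∙ y ∙ r) = ≤-trans
    (≤-reflexive (solve 3 (λ p y r → con 1 :+ (con 1 :+ (y :+ p) :+ r) := con 1 :+ (p :+ (con 1 :+ (y :+ r))))
                        refl (size p) (size y) (size r)))
    (m≤m+n _ 4)

-- The unary index drives the shifts. Then the bit in focus is replaced by true, and the prefix is
-- moved back: with `tl`, which picks the entry out of `e ∙ x`, `mapOnto` is plain reversal onto the
-- rest.
setBit : Tree → Tree
setBit v = mapOnto tl leaf (hd r) ((leaf ∙ leaf) ∙ tl (tl r))
  where r = foldTree shift leaf (hd v) (leaf ∙ tl v)

opaque
  setBitP : PolyTime setBit
  setBitP = (leafP ∙P hdP ∙P leafP ∙P tlP) ⨾P foldP {g = 1} shiftP shift-additive
            ⨾P (leafP ∙P hdP ∙P (leafP ∙P leafP) ∙P (tlP ⨾P tlP)) ⨾P mapOntoP tlP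

encodeBits : ∀ {m} → Subset m → Tree
encodeBits S = encodeList encodeBool (toList S)

setBit-encode : ∀ {m} (i : Fin m) (S : Subset m) →
                setBit (encodeℕ (toℕ i) ∙ encodeBits S) ≡ encodeBits (S [ i ]≔ true)
setBit-encode i S = go i leaf S
  where
  finish : Tree → Tree
  finish r = mapOnto tl leaf (hd r) ((leaf ∙ leaf) ∙ tl (tl r))
  -- The induction on `i` needs an arbitrary reversed prefix `p`.
  go : ∀ {m} (i : Fin m) p (S : Subset m) →
       finish (foldTree shift leaf (encodeℕ (toℕ i)) (p ∙ encodeBits S)) ≡
       mapOnto tl leaf p (encodeBits (S [ i ]≔ true))
  go zero    p (x ∷ S) = refl
  go (suc i) p (x ∷ S) = go i (encodeBool x ∙ p) S

-- Multiplication of systems by variables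

RawPoly RawSystem : ℕ → Set
RawPoly m   = List (Subset m)
RawSystem m = List (RawPoly m)

encodeRawPoly : ∀ {m} → RawPoly m → Tree
encodeRawPoly = encodeList encodeBits

encodeRawSystem : ∀ {m} → RawSystem m → Tree
encodeRawSystem = encodeList encodeRawPoly

-- Since squares of variables reduce, setting bit `i` of each monomial is multiplication by the
-- variable `i`. Monomials that become equal stay listed and cancel in the sum.
times : ∀ {m} → Fin m → RawPoly m → RawPoly m
times i p = map (_[ i ]≔ true) p ʳ++ []

-- With `A = B` this is a round of multiplication that also keeps the multiples of lower degree. A
-- different `A` lets the base system take products of a polynomial without the polynomial itself.
expand : ∀ {m} j → j ≤ m → RawSystem m → RawSystem m → RawSystem m
expand zero    _   B A = A
expand (suc j) j<m B A = expand j (<⇒≤ j<m) B (map (times (fromℕ< j<m)) B ʳ++ A)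

timesTree : Tree → Tree
timesTree v = mapOnto setBit (hd v) (tl v) leaf

opaque
  timesTreeP : PolyTime timesTree
  timesTreeP = (hdP ∙P tlP ∙P leafP) ⨾P mapOntoP setBitP

-- The list is encodeℕ j, and the tails of its non-empty suffixes are the indices j - 1, …, 0.
expandStep : Tree → Tree
expandStep u = mapOnto timesTree (tl (hd (tl u))) (hd u) (tl (tl u))

opaque
  expandStepP : PolyTime expandStep
  expandStepP = ((tlP ⨾P hdP ⨾P tlP) ∙P hdP ∙P (tlP ⨾P tlP)) ⨾P mapOntoP timesTreeP

-- The inner fold runs over the fixed system `e` with the index `l` as environment, so its growth
-- depends on these two only; the factor `size e` costs one more unit of exponent.
expandStep-additive : Additive expandStep (2 + degree timesTreeP)
expandStep-additive e x l a = begin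
  size (mapOnto timesTree l e a)
    ≤⟨ foldTree-size {g = g} (mapStep-additive timesTreeP) l e a
         (^-base-≤ g (≤-trans (≤-reflexive (cong suc (+-comm (size l) (size e))))
                              (size-∙-monoʳ e l (x ∙ l) (size-right x l)))) ⟩
  size a + size e * (2 + s) ^ g
    ≤⟨ +-monoʳ-≤ (size a) (*-monoˡ-≤ ((2 + s) ^ g) (m≤n⇒m≤o+n 3 (m≤m+n (size e) _))) ⟩
  size a + (2 + s) ^ suc g ∎
  where
  open ≤-Reasoning
  s = size (e ∙ x ∙ l)
  g = suc (degree timesTreeP)

expandTree : Tree → Tree → Tree → Tree
expandTree = foldTree expandStep

opaque
  expandTreeP : PolyTime (λ v → expandTree (hd v) (hd (tl v)) (tl (tl v)))
  expandTreeP = foldP {g = 2 + degree timesTreeP} expandStepP expandStep-additive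

timesTree-encode : ∀ {m} (i : Fin m) p →
                   timesTree (encodeℕ (toℕ i) ∙ encodeRawPoly p) ≡ encodeRawPoly (times i p)
timesTree-encode i p = mapOnto-encode {enc′ = encodeBits} {f = setBit} (_[ i ]≔ true) (setBit-encode i) p []

expandTree-encode : ∀ {m} j (j≤m : j ≤ m) B A →
  expandTree (encodeRawSystem B) (encodeℕ j) (encodeRawSystem A) ≡ encodeRawSystem (expand j j≤m B A)
expandTree-encode zero    _   B A = refl
expandTree-encode (suc j) j<m B A =
  trans (cong (expandTree (encodeRawSystem B) (encodeℕ j)) step)
        (expandTree-encode j (<⇒≤ j<m) B (map (times (fromℕ< j<m)) B ʳ++ A))
  where
  step : mapOnto timesTree (encodeℕ j) (encodeRawSystem B) (encodeRawSystem A) ≡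
         encodeRawSystem (map (times (fromℕ< j<m)) B ʳ++ A)
  step = subst (λ k → mapOnto timesTree (encodeℕ k) (encodeRawSystem B) (encodeRawSystem A) ≡
                         encodeRawSystem (map (times (fromℕ< j<m)) B ʳ++ A))
               (toℕ-fromℕ< j<m)
               (mapOnto-encode {f = timesTree} (times (fromℕ< j<m)) (timesTree-encode (fromℕ< j<m)) B A)

-- The base system and its multiples

x₀ : ∀ {n} → Subset (suc n)
x₀ = true ∷ ∅

-- A negated literal is false where its variable is 1, so its factor is the variable; for a positive
-- one the factor is 1 plus the variable, hence the extra summand `p`. The shift `suc i` leaves
-- index 0 to `x₀`.
timesFalsity : ∀ {n} → Literal n → RawPoly (suc n) → RawPoly (suc n)
timesFalsity (false , i) p = map (_[ suc i ]≔ true) p ʳ++ []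
timesFalsity (true  , i) p = map (_[ suc i ]≔ true) p ʳ++ p

clausePoly : ∀ {n} → Clause n → RawPoly (suc n)
clausePoly (k ∷ l ∷ m ∷ []) = timesFalsity m (timesFalsity l (timesFalsity k (x₀ ∷ [])))

-- The list `∅ ∷ x₀ ∷ []` is `1 + x₀`, which has a constant term; only its products with the
-- variables enter the system.
baseSystem : ∀ {n} → 3CNF n → RawSystem (suc n)
baseSystem φ = expand _ ≤-refl ((∅ ∷ x₀ ∷ []) ∷ []) (map clausePoly (clauses φ) ʳ++ [])

multiples : ∀ {m} → ℕ → RawSystem m → RawSystem m
multiples zero    B = B
multiples (suc e) B = expand _ ≤-refl (multiples e B) (multiples e B)

-- Prefixing `leaf` to the unary index shifts it past `x₀`; the sign of the literal decides whether
-- the accumulator starts as `p` or empty.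
timesFalsityTree : Tree → Tree
timesFalsityTree v = mapOnto setBit (leaf ∙ tl (hd v)) (tl v) (branch (hd (hd v)) (tl v) leaf)

opaque
  timesFalsityTreeP : PolyTime timesFalsityTree
  timesFalsityTreeP =
    ((leafP ∙P (hdP ⨾P tlP)) ∙P tlP ∙P branchP (hdP ⨾P hdP) tlP leafP) ⨾P mapOntoP setBitP

timesFalsityTree-encode : ∀ {n} (l : Literal n) p →
  timesFalsityTree (encodeLiteral l ∙ encodeRawPoly p) ≡ encodeRawPoly (timesFalsity l p)
timesFalsityTree-encode (false , i) p =
  mapOnto-encode {enc′ = encodeBits} {f = setBit} (_[ suc i ]≔ true) (setBit-encode (suc i)) p []
timesFalsityTree-encode (true , i) p =
  mapOnto-encode {enc′ = encodeBits} {f = setBit} (_[ suc i ]≔ true) (setBit-encode (suc i)) p p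

-- A false bit and a unary successor are both `leaf ∙_`, so the number `n` in the input doubles as
-- the empty monomial.
encodeBits-∅ : ∀ n → encodeBits (∅ {n}) ≡ encodeℕ n
encodeBits-∅ zero    = refl
encodeBits-∅ (suc n) = cong (leaf ∙_) (encodeBits-∅ n)

clauseTree : Tree → Tree
clauseTree v = timesFalsityTree (hd (tl (tl (tl v))) ∙
               timesFalsityTree (hd (tl (tl v)) ∙
               timesFalsityTree (hd (tl v) ∙ ((leaf ∙ leaf) ∙ hd v) ∙ leaf)))

opaque
  clauseTreeP : PolyTime clauseTree
  clauseTreeP = ((tlP ⨾P tlP ⨾P tlP ⨾P hdP) ∙P
               (((tlP ⨾P tlP ⨾P hdP) ∙P
               (((tlP ⨾P hdP) ∙P ((leafP ∙P leafP) ∙P hdP) ∙P leafP)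
               ⨾P timesFalsityTreeP)) ⨾P timesFalsityTreeP)) ⨾P timesFalsityTreeP

clauseTree-encode : ∀ {n} (C : Clause n) →
  clauseTree (encodeℕ n ∙ encodeClause C) ≡ encodeRawPoly (clausePoly C)
clauseTree-encode {n} (k ∷ l ∷ m ∷ []) =
  trans (cong (λ u → F m (F l (F k (((leaf ∙ leaf) ∙ u) ∙ leaf)))) (sym (encodeBits-∅ n)))
  (trans (cong (λ u → F m (F l u)) (timesFalsityTree-encode k (x₀ ∷ [])))
  (trans (cong (F m) (timesFalsityTree-encode l _))
         (timesFalsityTree-encode m _)))
  where
  F : Literal n → Tree → Tree
  F l p = timesFalsityTree (encodeLiteral l ∙ p)

initTree : Tree → Tree
initTree v = hd v ∙
  expandTree (((leaf ∙ hd v) ∙ ((leaf ∙ leaf) ∙ hd v) ∙ leaf) ∙ leaf) (leaf ∙ hd v)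
             (mapOnto clauseTree (hd v) (tl v) leaf)

opaque
  initTreeP : PolyTime initTree
  initTreeP = hdP ∙P
    ((((leafP ∙P hdP) ∙P ((leafP ∙P leafP) ∙P hdP) ∙P leafP) ∙P leafP) ∙P (leafP ∙P hdP) ∙P
     ((hdP ∙P tlP ∙P leafP) ⨾P mapOntoP clauseTreeP)) ⨾P expandTreeP

initTree-encode : ∀ {n} (φ : 3CNF n) →
  initTree (encode3CNF φ) ≡ encodeℕ n ∙ encodeRawSystem (baseSystem φ)
initTree-encode {n} φ = cong (encodeℕ n ∙_)
  (trans (cong₂ (λ u w → expandTree (((leaf ∙ u) ∙ ((leaf ∙ leaf) ∙ u) ∙ leaf) ∙ leaf) (encodeℕ (suc n)) w)
           (sym (encodeBits-∅ n))
           (mapOnto-encode {enc′ = encodeRawPoly} {f = clauseTree} clausePoly clauseTree-encode (clauses φ) []))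
         (expandTree-encode (suc n) ≤-refl ((∅ ∷ x₀ ∷ []) ∷ []) (map clausePoly (clauses φ) ʳ++ [])))

-- The number `n` stays beside the system because every round needs it: `leaf ∙ hd v` is the list of
-- the `n + 1` variables.
multiplyTree : Tree → Tree
multiplyTree v = hd v ∙ expandTree (tl v) (leaf ∙ hd v) (tl v)

opaque
  multiplyTreeP : PolyTime multiplyTree
  multiplyTreeP = hdP ∙P (tlP ∙P (leafP ∙P hdP) ∙P tlP) ⨾P expandTreeP

multiplyTree-encode : ∀ {n} (B : RawSystem (suc n)) →
  multiplyTree (encodeℕ n ∙ encodeRawSystem B) ≡ encodeℕ n ∙ encodeRawSystem (multiples 1 B)
multiplyTree-encode {n} B = cong (encodeℕ n ∙_) (expandTree-encode (suc n) ≤-refl B B)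

-- Sizes of systems

size-mapʳ++ : ∀ {A B : Set} {enc : A → Tree} {enc′ : B → Tree} {h : A → B} c → 1 ≤ c →
              (∀ x → size (enc′ (h x)) ≤ c * size (enc x)) → ∀ xs ys →
              size (encodeList enc′ (map h xs ʳ++ ys)) ≤
              c * size (encodeList enc xs) + size (encodeList enc′ ys)
size-mapʳ++ c 1≤c h≤ [] ys = m≤n+m _ (c * 1)
size-mapʳ++ {enc = enc} {enc′} {h} c 1≤c h≤ (x ∷ xs) ys = begin
  size (encodeList enc′ (map h xs ʳ++ (h x ∷ ys)))
    ≤⟨ size-mapʳ++ c 1≤c h≤ xs (h x ∷ ys) ⟩
  c * s + (1 + (size (enc′ (h x)) + t))
    ≤⟨ +-monoʳ-≤ (c * s) (+-mono-≤ 1≤c (+-monoˡ-≤ t (h≤ x))) ⟩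
  c * s + (c + (c * size (enc x) + t))
    ≡⟨ solve 4 (λ c s x t → c :* s :+ (c :+ (c :* x :+ t)) := c :* (con 1 :+ (x :+ s)) :+ t)
             refl c s (size (enc x)) t ⟩
  c * size (enc x ∙ encodeList enc xs) + t ∎
  where
  open ≤-Reasoning
  s = size (encodeList enc xs)
  t = size (encodeList enc′ ys)

-- A single bit grows, from size 1 to 3. The multiplicative form is the one that passes through
-- lists of monomials.
size-setBit : ∀ {m} (i : Fin m) S → size (encodeBits (S [ i ]≔ true)) ≤ 2 * size (encodeBits S)
size-setBit zero (x ∷ S) = begin
  4 + s
    ≤⟨ +-mono-≤ (+-monoʳ-≤ 2 (*-monoʳ-≤ 2 (1≤size (encodeBool x)))) (m≤m+n s (s + 0)) ⟩
  2 + 2 * b + 2 * s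
    ≡⟨ solve 2 (λ b s → con 2 :+ con 2 :* b :+ con 2 :* s := con 2 :* (con 1 :+ (b :+ s))) refl b s ⟩
  2 * size (encodeBits (x ∷ S)) ∎
  where
  open ≤-Reasoning
  s = size (encodeBits S)
  b = size (encodeBool x)
size-setBit (suc i) (x ∷ S) = begin
  1 + (b + size (encodeBits (S [ i ]≔ true))) ≤⟨ +-monoʳ-≤ 1 (+-monoʳ-≤ b (size-setBit i S)) ⟩
  1 + (b + 2 * s)                            ≤⟨ m≤m+n _ (1 + b) ⟩
  1 + (b + 2 * s) + (1 + b)
    ≡⟨ solve 2 (λ b s → con 1 :+ (b :+ con 2 :* s) :+ (con 1 :+ b) := con 2 :* (con 1 :+ (b :+ s)))
             refl b s ⟩
  2 * size (encodeBits (x ∷ S)) ∎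
  where
  open ≤-Reasoning
  s = size (encodeBits S)
  b = size (encodeBool x)

size-times : ∀ {m} (i : Fin m) p → size (encodeRawPoly (times i p)) ≤ 3 * size (encodeRawPoly p)
size-times i p = ≤-trans (size-mapʳ++ 2 (s≤s z≤n) (size-setBit i) p [])
  (≤-trans (+-monoʳ-≤ (2 * s) (1≤size (encodeRawPoly p)))
           (≤-reflexive (solve 1 (λ s → con 2 :* s :+ s := con 3 :* s) refl s)))
  where s = size (encodeRawPoly p)

size-expand : ∀ {m} j (j≤m : j ≤ m) B A →
  size (encodeRawSystem (expand j j≤m B A)) ≤ j * (3 * size (encodeRawSystem B)) + size (encodeRawSystem A)
size-expand zero    _   B A = ≤-refl
size-expand (suc j) j<m B A = begin
  size (encodeRawSystem (expand j (<⇒≤ j<m) B (map (times (fromℕ< j<m)) B ʳ++ A)))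
    ≤⟨ size-expand j (<⇒≤ j<m) B _ ⟩
  j * b + size (encodeRawSystem (map (times (fromℕ< j<m)) B ʳ++ A))
    ≤⟨ +-monoʳ-≤ (j * b) (size-mapʳ++ 3 (s≤s z≤n) (size-times (fromℕ< j<m)) B A) ⟩
  j * b + (b + size (encodeRawSystem A))
    ≡⟨ solve 3 (λ j b a → j :* b :+ (b :+ a) := b :+ j :* b :+ a) refl j b (size (encodeRawSystem A)) ⟩
  suc j * b + size (encodeRawSystem A) ∎
  where
  open ≤-Reasoning
  b = 3 * size (encodeRawSystem B)

state : ∀ {n} → RawSystem (suc n) → Tree
state {n} B = encodeℕ n ∙ encodeRawSystem B

-- Linear in the current size, with a factor in `n` only: `e` rounds then add `2 * e` to the
-- exponent. Composing the generic `PolyTime` bounds would multiply exponents, which is exponential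
-- in `e`.
size-multiples : ∀ {n} (B : RawSystem (suc n)) →
                 size (state (multiples 1 B)) ≤ (2 + n) ^ 2 * size (state B)
size-multiples {n} B = begin
  1 + (ν + size (encodeRawSystem (multiples 1 B)))
    ≤⟨ +-monoʳ-≤ 1 (+-monoʳ-≤ ν (size-expand (suc n) ≤-refl B B)) ⟩
  1 + (ν + (suc n * (3 * b) + b))
    ≤⟨ m≤m+n _ _ ⟩
  1 + (ν + (suc n * (3 * b) + b)) + ((n * n + n) * b + (n * n + 4 * n + 3) * (1 + ν))
    ≡⟨ solve 3 (λ n ν b →
         con 1 :+ (ν :+ ((con 1 :+ n) :* (con 3 :* b) :+ b)) :+
         ((n :* n :+ n) :* b :+ (n :* n :+ con 4 :* n :+ con 3) :* (con 1 :+ ν))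
         := (con 2 :+ n) :* ((con 2 :+ n) :* con 1) :* (con 1 :+ (ν :+ b))) refl n ν b ⟩
  (2 + n) ^ 2 * (1 + (ν + b)) ∎
  where
  open ≤-Reasoning
  ν = size (encodeℕ n)
  b = size (encodeRawSystem B)

-- Size of the input

size-encodeℕ : ∀ n → size (encodeℕ n) ≡ 1 + (n + n)
size-encodeℕ zero    = refl
size-encodeℕ (suc n) = cong (2 +_) (trans (size-encodeℕ n) (sym (+-suc n n)))

size-encodeList : ∀ {A : Set} {enc : A → Tree} {K} → (∀ x → size (enc x) ≤ K) →
                  ∀ xs → size (encodeList enc xs) ≤ 1 + length xs * (1 + K)
size-encodeList enc≤ []       = ≤-refl
size-encodeList {K = K} enc≤ (x ∷ xs) = s≤s (begin
  _ ≤⟨ +-mono-≤ (enc≤ x) (size-encodeList enc≤ xs) ⟩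
  K + (1 + length xs * (1 + K)) ≡⟨ +-suc K _ ⟩
  suc K + length xs * (1 + K) ∎)
  where open ≤-Reasoning

size-encodeLiteral : ∀ {n} (l : Literal n) → size (encodeLiteral l) ≤ 5 + (n + n)
size-encodeLiteral (b , i) = s≤s (+-mono-≤ (size-encodeBool b)
  (≤-trans (≤-reflexive (size-encodeℕ (toℕ i))) (s≤s (+-mono-≤ i≤ i≤))))
  where
  i≤ = <⇒≤ (toℕ<n i)
  size-encodeBool : ∀ b → size (encodeBool b) ≤ 3
  size-encodeBool false = s≤s z≤n
  size-encodeBool true  = ≤-refl

size-encodeClause : ∀ {n} (C : Clause n) → size (encodeClause C) ≤ 1 + 3 * (6 + (n + n))
size-encodeClause {n} C@(_ ∷ _ ∷ _ ∷ []) =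
  size-encodeList {enc = encodeLiteral} {5 + (n + n)} size-encodeLiteral (toList C)

Unique⇒lookup-injective : ∀ {A : Set} {xs : List A} → Unique xs → Injective _≡_ _≡_ (List.lookup xs)
Unique⇒lookup-injective (x∉ ∷ u) {zero}  {zero}  eq = refl
Unique⇒lookup-injective (x∉ ∷ u) {zero}  {suc j} eq = contradiction eq (All.lookup x∉ (∈-lookup j))
Unique⇒lookup-injective (x∉ ∷ u) {suc i} {zero}  eq = contradiction (sym eq) (All.lookup x∉ (∈-lookup i))
Unique⇒lookup-injective (x∉ ∷ u) {suc i} {suc j} eq = cong suc (Unique⇒lookup-injective u eq)

-- Pigeonhole: the positions of a duplicate-free list inject into the `k` codes.
length≤ : ∀ {A : Set} {k} {code : A → Fin k} → Injective _≡_ _≡_ code →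
          ∀ {xs} → Unique xs → length xs ≤ k
length≤ inj unique = injective⇒≤ (λ eq → Unique⇒lookup-injective unique (inj eq))

codeBool : Bool → Fin 2
codeBool false = zero
codeBool true  = suc zero

codeBool-injective : Injective _≡_ _≡_ codeBool
codeBool-injective {false} {false} eq = refl
codeBool-injective {true}  {true}  eq = refl

codeLiteral : ∀ {n} → Literal n → Fin (2 * n)
codeLiteral (b , i) = combine (codeBool b) i

codeLiteral-injective : ∀ {n} → Injective _≡_ _≡_ (codeLiteral {n})
codeLiteral-injective {n} {b , i} {c , j} eq =
  let (eq₁ , eq₂) = combine-injective (codeBool b) i (codeBool c) j eq
  in cong₂ _,_ (codeBool-injective eq₁) eq₂

codeClause : ∀ {n} → Clause n → Fin (2 * n * (2 * n * (2 * n)))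
codeClause (k ∷ l ∷ m ∷ []) = combine (codeLiteral k) (combine (codeLiteral l) (codeLiteral m))

codeClause-injective : ∀ {n} → Injective _≡_ _≡_ (codeClause {n})
codeClause-injective {n} {k ∷ l ∷ m ∷ []} {k′ ∷ l′ ∷ m′ ∷ []} eq
  with eq₁ , eq₂₃ ← combine-injective (codeLiteral k) _ (codeLiteral k′) _ eq
  with eq₂ , eq₃ ← combine-injective (codeLiteral l) _ (codeLiteral l′) _ eq₂₃
  with refl ← codeLiteral-injective {n} {k} {k′} eq₁
  with refl ← codeLiteral-injective {n} {l} {l′} eq₂
  with refl ← codeLiteral-injective {n} {m} {m′} eq₃ = refl

const-poly : ∀ c → PolyBounded (λ _ → c)
const-poly zero    = 0 , λ _ → z≤n
const-poly (suc c) = +-poly 1-poly (const-poly c)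

-- The unary `n`, and at most `(2n)^3` distinct clauses, each with the node that lists it. This
-- turns bounds in the input size into bounds in `n`.
inputSize : ℕ → ℕ
inputSize n = 1 + ((1 + (n + n)) + (1 + 2 * n * (2 * n * (2 * n)) * (2 + 3 * (6 + (n + n)))))

inputSize-poly : PolyBounded inputSize
inputSize-poly = +-poly 1-poly (+-poly (+-poly 1-poly n+n) (+-poly 1-poly
  (*-poly (*-poly 2n (*-poly 2n 2n))
    (+-poly (const-poly 2) (*-poly (const-poly 3) (+-poly (const-poly 6) n+n))))))
  where
  n+n : PolyBounded (λ n → n + n)
  n+n = +-poly id-poly id-poly
  2n : PolyBounded (λ n → 2 * n)
  2n = *-poly (const-poly 2) id-poly

size-encode3CNF : ∀ {n} (φ : 3CNF n) → size (encode3CNF φ) ≤ inputSize n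
size-encode3CNF {n} φ = s≤s (+-mono-≤ (≤-reflexive (size-encodeℕ n))
  (≤-trans (size-encodeList {enc = encodeClause} size-encodeClause (clauses φ))
           (s≤s (*-monoˡ-≤ (2 + 3 * (6 + (n + n))) (length≤ codeClause-injective (distinct φ))))))

-- Running time of the reduction

-- The rounds are unrolled in the program, as their number depends on the degree `d` alone and not
-- on the instance.
rounds : ℕ → Program
rounds zero    = program initTreeP
rounds (suc e) = rounds e ⨾ program multiplyTreeP

opaque
  time₀ : PolyBounded (λ n → (2 + inputSize n) ^ degree initTreeP)
  time₀ = ^-poly inputSize-poly (degree initTreeP)

  k₀ : ℕ
  k₀ = exponent time₀

  init-runs : ∀ {n} (φ : 3CNF n) →
    Halts (program initTreeP) (encode3CNF φ) (state (baseSystem φ)) ((2 + n) ^ k₀)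
  init-runs {n} φ =
    let (t , r , t≤) = Halts-cong (runs initTreeP (encode3CNF φ)) (initTree-encode φ) in
    t , r , ≤-trans (≤-trans t≤ (^-base-≤ (degree initTreeP) (size-encode3CNF φ)))
            (bound time₀ n)

k₁ : ℕ
k₁ = degree multiplyTreeP

system : ∀ {n} → 3CNF n → ℕ → RawSystem (suc n)
system φ e = multiples e (baseSystem φ)

size-state : ∀ {n} e (φ : 3CNF n) → size (state (system φ e)) ≤ (2 + n) ^ (e * 2 + k₀)
size-state zero φ = let (_ , r , t≤) = init-runs φ in ≤-trans (output≤time r) t≤
size-state {n} (suc e) φ = begin
  size (state (system φ (suc e)))         ≤⟨ size-multiples (system φ e) ⟩
  (2 + n) ^ 2 * size (state (system φ e)) ≤⟨ *-monoʳ-≤ ((2 + n) ^ 2) (size-state e φ) ⟩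
  (2 + n) ^ 2 * (2 + n) ^ (e * 2 + k₀)    ≡⟨ sym (^-distribˡ-+-* (2 + n) 2 (e * 2 + k₀)) ⟩
  (2 + n) ^ (suc e * 2 + k₀)              ∎
  where open ≤-Reasoning

-- The constant `c` of the theorem. A round on a system of size at most `(2 + n) ^ (e * 2 + k₀)` has
-- time exponent `(2 + (e * 2 + k₀)) * k₁`, which is at most `suc e` times this product.
degreeFactor : ℕ
degreeFactor = (2 + k₀) * suc k₁

1≤degreeFactor : 1 ≤ degreeFactor
1≤degreeFactor = s≤s z≤n

rounds-run : ∀ {n} e (φ : 3CNF n) →
  Halts (rounds e) (encode3CNF φ) (state (multiples e (baseSystem φ))) ((2 + n) ^ (suc e * degreeFactor))
rounds-run {n} zero φ = let (t , r , t≤) = init-runs φ in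
  t , r , ≤-trans t≤ (^-exponent-≤ n
    (≤-trans (m≤n+m k₀ 2) (≤-trans (m≤m*n (2 + k₀) (suc k₁)) (m≤m+n degreeFactor 0))))
rounds-run {n} (suc e) φ with rounds-run e φ
   | Halts-cong (runs multiplyTreeP (state (system φ e))) (multiplyTree-encode (system φ e))
... | s , r , s≤ | t , r′ , t≤ =
  s + t , seq-run r r′ ,
  -- The earlier rounds and the last one obey the same bound, so their sum costs one unit of
  -- exponent, within the `degreeFactor` allotted to the new round.
  ≤-trans (double-^ n (suc e * degreeFactor) s≤ t≤′)
          (^-exponent-≤ n (+-monoˡ-≤ (suc e * degreeFactor) 1≤degreeFactor))
  where
  exponent≤ : (2 + (e * 2 + k₀)) * k₁ ≤ suc e * degreeFactor
  exponent≤ = begin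
    (2 + (e * 2 + k₀)) * k₁
      ≤⟨ m≤m+n _ (2 + (e * 2 + k₀) + e * k₀ * suc k₁) ⟩
    (2 + (e * 2 + k₀)) * k₁ + (2 + (e * 2 + k₀) + e * k₀ * suc k₁)
      ≡⟨ solve 3 (λ e k l → (con 2 :+ (e :* con 2 :+ k)) :* l :+
                     (con 2 :+ (e :* con 2 :+ k) :+ e :* k :* (con 1 :+ l))
                  := (con 1 :+ e) :* ((con 2 :+ k) :* (con 1 :+ l))) refl e k₀ k₁ ⟩
    suc e * degreeFactor ∎
    where open ≤-Reasoning
  t≤′ : t ≤ (2 + n) ^ (suc e * degreeFactor)
  t≤′ = ≤-trans t≤ (≤-trans (^-compose n (e * 2 + k₀) k₁ (size-state e φ)) (^-exponent-≤ n exponent≤))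

reduction-runs : ∀ {n} e (φ : 3CNF n) →
  Halts (rounds e ⨾ tail) (encode3CNF φ) (encodeRawSystem (multiples e (baseSystem φ)))
        ((2 + n) ^ (degreeFactor * (e + 4)))
reduction-runs {n} e φ =
  let (t , r , t≤) = rounds-run e φ in
  t + size (state B) , seq-run r tail-node ,
  -- The final `tail` is charged the size of the state, which is bounded by the time that produced
  -- it.
  ≤-trans (double-^ n (suc e * degreeFactor) t≤ (≤-trans (output≤time r) t≤)) (^-exponent-≤ n exponent≤)
  where
  B = multiples e (baseSystem φ)
  open ≤-Reasoning
  exponent≤ : suc (suc e * degreeFactor) ≤ degreeFactor * (e + 4)
  exponent≤ = begin
    suc (suc e * degreeFactor)      ≤⟨ +-monoˡ-≤ (suc e * degreeFactor) 1≤degreeFactor ⟩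
    (2 + e) * degreeFactor          ≤⟨ *-monoˡ-≤ degreeFactor (m≤n+m (2 + e) 2) ⟩
    (4 + e) * degreeFactor          ≡⟨ *-comm (4 + e) degreeFactor ⟩
    degreeFactor * (4 + e)          ≡⟨ cong (degreeFactor *_) (+-comm 4 e) ⟩
    degreeFactor * (e + 4)          ∎

-- Evaluation

All-mapʳ++ : ∀ {A B : Set} {P : A → Set} {Q : B → Set} {h : A → B} {xs ys} →
             (∀ {x} → P x → Q (h x)) → All P xs → All Q ys → All Q (map h xs ʳ++ ys)
All-mapʳ++ f []         qys = qys
All-mapʳ++ f (px ∷ pxs) qys = All-mapʳ++ f pxs (f px ∷ qys)

∈-ʳ++⁺ʳ : ∀ {A : Set} {y : A} xs {ys} → y ∈ ys → y ∈ xs ʳ++ ys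
∈-ʳ++⁺ʳ []       y∈ = y∈
∈-ʳ++⁺ʳ (x ∷ xs) y∈ = ∈-ʳ++⁺ʳ xs (there y∈)

∈-mapʳ++⁺ˡ : ∀ {A B : Set} (h : A → B) {x xs ys} → x ∈ xs → h x ∈ map h xs ʳ++ ys
∈-mapʳ++⁺ˡ h {xs = _ ∷ xs} (here refl) = ∈-ʳ++⁺ʳ (map h xs) (here refl)
∈-mapʳ++⁺ˡ h (there x∈)                = ∈-mapʳ++⁺ˡ h x∈

value : ∀ {m} → RawPoly m → Vec 𝔽₂ m → 𝔽₂
value p a = ∑ (map (λ S → monomial S a) p)

monomial-∅ : ∀ {m} (a : Vec 𝔽₂ m) → monomial ∅ a ≡ true
monomial-∅ []      = refl
monomial-∅ (b ∷ a) = monomial-∅ a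

∧-swap : ∀ x y z → x ∧ (y ∧ z) ≡ y ∧ (x ∧ z)
∧-swap false y z = sym (∧-zeroʳ y)
∧-swap true  y z = refl

monomial-setBit : ∀ {m} (i : Fin m) S a → monomial (S [ i ]≔ true) a ≡ lookup a i ∧ monomial S a
monomial-setBit zero    (true  ∷ S) (true  ∷ a) = refl
monomial-setBit zero    (true  ∷ S) (false ∷ a) = refl
monomial-setBit zero    (false ∷ S) (b ∷ a) = refl
monomial-setBit (suc i) (true  ∷ S) (b ∷ a) =
  trans (cong (b ∧_) (monomial-setBit i S a)) (∧-swap b (lookup a i) (monomial S a))
monomial-setBit (suc i) (false ∷ S) (b ∷ a) = monomial-setBit i S a

value-mapʳ++ : ∀ {m} (i : Fin m) p q a →
  value (map (_[ i ]≔ true) p ʳ++ q) a ≡ (lookup a i ∧ value p a) xor value q a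
value-mapʳ++ i []      q a = cong (_xor value q a) (sym (∧-zeroʳ (lookup a i)))
value-mapʳ++ i (S ∷ p) q a = begin
  value (map (_[ i ]≔ true) p ʳ++ ((S [ i ]≔ true) ∷ q)) a
    ≡⟨ value-mapʳ++ i p _ a ⟩
  (c ∧ value p a) xor (monomial (S [ i ]≔ true) a xor value q a)
    ≡⟨ cong (λ x → (c ∧ value p a) xor (x xor value q a)) (monomial-setBit i S a) ⟩
  (c ∧ value p a) xor ((c ∧ monomial S a) xor value q a)
    ≡⟨ sym (xor-assoc (c ∧ value p a) _ _) ⟩
  ((c ∧ value p a) xor (c ∧ monomial S a)) xor value q a
    ≡⟨ cong (_xor value q a) (trans (xor-comm (c ∧ value p a) _) (sym (∧-distribˡ-xor c _ _))) ⟩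
  (c ∧ value (S ∷ p) a) xor value q a ∎
  where
  open ≡-Reasoning
  c = lookup a i

value-times : ∀ {m} (i : Fin m) p a → value (times i p) a ≡ lookup a i ∧ value p a
value-times i p a = trans (value-mapʳ++ i p [] a) (xor-identityʳ _)

falsity : ∀ {n} → Literal n → Vec Bool n → Bool
falsity (b , i) v = lookup v i xor b

value-timesFalsity : ∀ {n} (l : Literal n) p c v →
  value (timesFalsity l p) (c ∷ v) ≡ falsity l v ∧ value p (c ∷ v)
value-timesFalsity (false , i) p c v =
  trans (value-times (suc i) p (c ∷ v)) (cong (_∧ value p (c ∷ v)) (sym (xor-identityʳ (lookup v i))))
value-timesFalsity (true , i) p c v = trans (value-mapʳ++ (suc i) p p (c ∷ v)) (lemma (lookup v i) _)
  where
  lemma : ∀ x y → (x ∧ y) xor y ≡ (x xor true) ∧ y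
  lemma false y = refl
  lemma true  y = xor-same y

value-clausePoly : ∀ {n} (k l m : Literal n) c v →
  value (clausePoly (k ∷ l ∷ m ∷ [])) (c ∷ v) ≡ falsity m v ∧ (falsity l v ∧ (falsity k v ∧ c))
value-clausePoly k l m c v =
  trans (value-timesFalsity m (timesFalsity l (timesFalsity k (x₀ ∷ []))) c v) (cong (falsity m v ∧_)
  (trans (value-timesFalsity l (timesFalsity k (x₀ ∷ [])) c v) (cong (falsity l v ∧_)
  (trans (value-timesFalsity k (x₀ ∷ []) c v) (cong (falsity k v ∧_)
  (trans (xor-identityʳ _) (trans (cong (c ∧_) (monomial-∅ v)) (∧-identityʳ c))))))))

value-1+x₀ : ∀ {n} c (v : Vec Bool n) → value (∅ ∷ x₀ ∷ []) (c ∷ v) ≡ true xor c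
value-1+x₀ c v = cong₂ _xor_ (monomial-∅ v)
  (trans (xor-identityʳ _) (trans (cong (c ∧_) (monomial-∅ v)) (∧-identityʳ c)))

-- Closure of systems under multiplication

All-expand : ∀ {m} {P Q : RawPoly m → Set} → (∀ i {p} → P p → Q (times i p)) →
             ∀ {j} (j≤m : j ≤ m) {B A} → All P B → All Q A → All Q (expand j j≤m B A)
All-expand f {zero}  _   PB QA = QA
All-expand f {suc j} j<m PB QA =
  All-expand f (<⇒≤ j<m) PB (All-mapʳ++ (f (fromℕ< j<m)) PB QA)

⊆-expand : ∀ {m} {j} (j≤m : j ≤ m) {B A : RawSystem m} {q} → q ∈ A → q ∈ expand j j≤m B A
⊆-expand {j = zero}  _   q∈ = q∈
⊆-expand {j = suc j} j<m {B} q∈ = ⊆-expand (<⇒≤ j<m) (∈-ʳ++⁺ʳ (map (times (fromℕ< j<m)) B) q∈)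

times∈expand : ∀ {m} {j} (j≤m : j ≤ m) {B A : RawSystem m} {p} (i : Fin m) → toℕ i < j →
               p ∈ B → times i p ∈ expand j j≤m B A
times∈expand {j = suc j} j<m {B} {A} {p} i (s≤s i≤j) p∈ with m≤n⇒m<n∨m≡n i≤j
... | inj₁ i<j  = times∈expand (<⇒≤ j<m) i i<j p∈
... | inj₂ refl = ⊆-expand (<⇒≤ j<m)
  (subst (λ k → times k p ∈ map (times (fromℕ< j<m)) B ʳ++ A) (fromℕ<-toℕ i j<m)
         (∈-mapʳ++⁺ˡ (times (fromℕ< j<m)) p∈))

-- The grade `k` rises by one per round, as a degree bound does; a constant family yields an
-- invariant such as vanishing at a point.
All-multiples : ∀ {m} {P : ℕ → RawPoly m → Set} → (∀ i {k p} → P k p → P (suc k) (times i p)) →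
                (∀ {k p} → P k p → P (suc k) p) →
                ∀ e {k B} → All (P k) B → All (P (e + k)) (multiples e B)
All-multiples f w zero    PB = PB
All-multiples {P = P} f w (suc e) {k} PB =
  let PB′ = All-multiples {P = P} f w e PB
  in All-expand {P = P (e + k)} (λ i → f i) ≤-refl PB′ (All.map w PB′)

monomial-peel : ∀ {m} (S : Subset m) → (∀ a → monomial S a ≡ true) ⊎
  (Σ[ i ∈ Fin m ] Σ[ T ∈ Subset m ] (∣ S ∣ ≡ suc ∣ T ∣ × (∀ a → monomial S a ≡ lookup a i ∧ monomial T a)))
monomial-peel []          = inj₁ λ { [] → refl }
monomial-peel (true  ∷ S) = inj₂ (zero , false ∷ S , refl , λ { (b ∷ a) → refl })
monomial-peel (false ∷ S) with monomial-peel S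
... | inj₁ S≡1                = inj₁ λ { (b ∷ a) → S≡1 a }
... | inj₂ (i , T , eq , S≡iT) = inj₂ (suc i , false ∷ T , eq , λ { (b ∷ a) → S≡iT a })

∣∅∣≡0 : ∀ m → ∣ ∅ {m} ∣ ≡ 0
∣∅∣≡0 zero    = refl
∣∅∣≡0 (suc m) = ∣∅∣≡0 m

∣∅∣≤ : ∀ m {d} → ∣ ∅ {m} ∣ ≤ d
∣∅∣≤ m = ≤-trans (≤-reflexive (∣∅∣≡0 m)) z≤n

-- Each round multiplies by one variable of `S`; once `S` is used up, the remaining rounds keep the
-- polynomial, because `expand` retains its accumulator.
multiples-complete : ∀ {m} e (S : Subset m) → ∣ S ∣ ≤ e → ∀ {B p} → p ∈ B →
  Σ[ q ∈ RawPoly m ] (q ∈ multiples e B × (∀ a → value q a ≡ monomial S a ∧ value p a))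
multiples-complete e S S≤e {p = p} p∈ with monomial-peel S
multiples-complete zero    S S≤e {p = p} p∈ | inj₁ S≡1 =
  p , p∈ , λ a → cong (_∧ value p a) (sym (S≡1 a))
multiples-complete {m} (suc e) S S≤e {B} {p} p∈ | inj₁ S≡1 =
  let (q , q∈ , q≡) = multiples-complete e ∅ (∣∅∣≤ m) p∈
  in q , ⊆-expand ≤-refl {multiples e B} q∈ ,
     λ a → trans (q≡ a) (cong (_∧ value p a) (trans (monomial-∅ a) (sym (S≡1 a))))
multiples-complete zero    S S≤e p∈ | inj₂ (i , T , eq , _) with () ← ≤-trans (≤-reflexive (sym eq)) S≤e
multiples-complete (suc e) S S≤e {B} {p} p∈ | inj₂ (i , T , eq , S≡iT) =
  let (q , q∈ , q≡) = multiples-complete e T (≤-pred (≤-trans (≤-reflexive (sym eq)) S≤e)) p∈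
  in times i q , times∈expand ≤-refl {multiples e B} {multiples e B} i (toℕ<n i) q∈ , λ a →
     trans (value-times i q a) (trans (cong (lookup a i ∧_) (q≡ a))
     (trans (sym (∧-assoc (lookup a i) _ _)) (cong (_∧ value p a) (sym (S≡iT a)))))

-- The minimum distance of the dual of a Reed–Muller code

part : ∀ {m} → Bool → List (Vec Bool (suc m)) → List (Vec Bool m)
part b     []                  = []
part true  ((true  ∷ v) ∷ γ) = v ∷ part true γ
part true  ((false ∷ v) ∷ γ) = part true γ
part false ((true  ∷ v) ∷ γ) = part false γ
part false ((false ∷ v) ∷ γ) = v ∷ part false γ

length-part : ∀ {m} (γ : List (Vec Bool (suc m))) →
              length γ ≡ length (part true γ) + length (part false γ)
length-part []                  = refl
length-part ((true  ∷ v) ∷ γ) = cong suc (length-part γ)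
length-part ((false ∷ v) ∷ γ) = trans (cong suc (length-part γ)) (sym (+-suc _ _))

∉-part : ∀ {m} b {v : Vec Bool m} {γ} → All (b ∷ v ≢_) γ → All (v ≢_) (part b γ)
∉-part b     []                                = []
∉-part true  {γ = (true  ∷ _) ∷ _} (v≢ ∷ v∉) = (λ { refl → v≢ refl }) ∷ ∉-part true v∉
∉-part true  {γ = (false ∷ _) ∷ _} (v≢ ∷ v∉) = ∉-part true v∉
∉-part false {γ = (true  ∷ _) ∷ _} (v≢ ∷ v∉) = ∉-part false v∉
∉-part false {γ = (false ∷ _) ∷ _} (v≢ ∷ v∉) = (λ { refl → v≢ refl }) ∷ ∉-part false v∉

Unique-part : ∀ {m} b {γ : List (Vec Bool (suc m))} → Unique γ → Unique (part b γ)
Unique-part b     []                                = []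
Unique-part true  {(true  ∷ _) ∷ _} (v∉ ∷ unique) = ∉-part true v∉ ∷ Unique-part true unique
Unique-part true  {(false ∷ _) ∷ _} (v∉ ∷ unique) = Unique-part true unique
Unique-part false {(true  ∷ _) ∷ _} (v∉ ∷ unique) = Unique-part false unique
Unique-part false {(false ∷ _) ∷ _} (v∉ ∷ unique) = ∉-part false v∉ ∷ Unique-part false unique

-- The inner product of the indicator function of `γ` with the monomial `S`.
moment : ∀ {m} → Subset m → List (Vec Bool m) → 𝔽₂
moment S γ = ∑ (map (monomial S) γ)

moment-part₁ : ∀ {m} (S : Subset m) γ → moment (true ∷ S) γ ≡ moment S (part true γ)
moment-part₁ S []                  = refl
moment-part₁ S ((true  ∷ v) ∷ γ) = cong (monomial S v xor_) (moment-part₁ S γ)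
moment-part₁ S ((false ∷ v) ∷ γ) = moment-part₁ S γ

moment-part : ∀ {m} (S : Subset m) γ →
              moment (false ∷ S) γ ≡ moment S (part true γ) xor moment S (part false γ)
moment-part S []                  = refl
moment-part S ((true  ∷ v) ∷ γ) =
  trans (cong (monomial S v xor_) (moment-part S γ)) (sym (xor-assoc (monomial S v) _ _))
moment-part S ((false ∷ v) ∷ γ) = begin
  monomial S v xor moment (false ∷ S) γ             ≡⟨ cong (monomial S v xor_) (moment-part S γ) ⟩
  monomial S v xor (t xor f)                        ≡⟨ sym (xor-assoc (monomial S v) t f) ⟩
  (monomial S v xor t) xor f                        ≡⟨ cong (_xor f) (xor-comm (monomial S v) t) ⟩
  (t xor monomial S v) xor f                        ≡⟨ xor-assoc t (monomial S v) f ⟩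
  t xor (monomial S v xor f)                        ∎
  where
  open ≡-Reasoning
  t = moment S (part true γ)
  f = moment S (part false γ)

empty? : ∀ {A : Set} (xs : List A) → xs ≡ [] ⊎ 1 ≤ length xs
empty? []      = inj₁ refl
empty? (_ ∷ _) = inj₂ (s≤s z≤n)

-- Split γ by the first coordinate x₀: multiplying by x₀ shows that the half x₀ = 1 is
-- orthogonal to degree < k - 1, and then so is the other half.
distance : ∀ {m} k (γ : List (Vec Bool m)) → Unique γ → 1 ≤ length γ →
           (∀ S → ∣ S ∣ < k → moment S γ ≡ false) → 2 ^ k ≤ length γ
distance zero γ unique γ≢[] orth = γ≢[]
-- Without coordinates the only non-empty set is one point, on which the constant monomial sums to
-- 1.
distance {zero} (suc k) ([] ∷ []) unique γ≢[] orth with () ← orth [] (s≤s z≤n)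
distance {zero} (suc k) ([] ∷ [] ∷ γ) ((v≢ ∷ _) ∷ _) γ≢[] orth = contradiction refl v≢
distance {suc m} (suc k) γ unique γ≢[] orth with empty? (part true γ) | empty? (part false γ)
-- When all points share their first coordinate, dropping it preserves every moment: the dimension
-- falls and `k` stays.
... | inj₁ t≡[] | _ = ≤-trans
  (distance (suc k) (part false γ) (Unique-part false unique) (≤-trans γ≢[] (≤-reflexive length≡))
    (λ S S<k → trans (cong (λ t → moment S t xor moment S (part false γ)) (sym t≡[]))
                     (trans (sym (moment-part S γ)) (orth (false ∷ S) S<k))))
  (≤-reflexive (sym length≡))
  where
  length≡ : length γ ≡ length (part false γ)
  length≡ = trans (length-part γ) (cong (λ t → length t + length (part false γ)) t≡[])
... | inj₂ _ | inj₁ f≡[] = ≤-trans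
  (distance (suc k) (part true γ) (Unique-part true unique) (≤-trans γ≢[] (≤-reflexive length≡))
    (λ S S<k → trans (sym (xor-identityʳ (moment S (part true γ))))
      (trans (cong (λ f → moment S (part true γ) xor moment S f) (sym f≡[]))
      (trans (sym (moment-part S γ)) (orth (false ∷ S) S<k)))))
  (≤-reflexive (sym length≡))
  where
  length≡ : length γ ≡ length (part true γ)
  length≡ = trans (length-part γ) (trans (cong (λ f → length (part true γ) + length f) f≡[]) (+-identityʳ _))
... | inj₂ t≢[] | inj₂ f≢[] = begin
  2 ^ suc k                                  ≡⟨ cong (2 ^ k +_) (+-identityʳ (2 ^ k)) ⟩
  2 ^ k + 2 ^ k                              ≤⟨ +-mono-≤
    (distance k (part true γ) (Unique-part true unique) t≢[] orth-t)
    (distance k (part false γ) (Unique-part false unique) f≢[] orth-f) ⟩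
  length (part true γ) + length (part false γ) ≡⟨ sym (length-part γ) ⟩
  length γ                                   ∎
  where
  open ≤-Reasoning
  orth-t : ∀ S → ∣ S ∣ < k → moment S (part true γ) ≡ false
  orth-t S S<k = trans (sym (moment-part₁ S γ)) (orth (true ∷ S) (s≤s S<k))
  orth-f : ∀ S → ∣ S ∣ < k → moment S (part false γ) ≡ false
  orth-f S S<k = trans (cong (_xor moment S (part false γ)) (sym (orth-t S S<k)))
    (trans (sym (moment-part S γ)) (orth (false ∷ S) (m≤n⇒m≤1+n S<k)))

-- Representations containing a non-zero of a base polynomial

support : ∀ {m} → RawPoly m → List (Vec 𝔽₂ m) → List (Vec 𝔽₂ m)
support p = filter (λ a → value p a ≟ᵇ true)

-- Pairing the support of `p` with a monomial sums their product over `β`, so the equations for the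
-- multiples of `p` become orthogonality relations.
moment-support : ∀ {m} S (p : RawPoly m) β →
                 moment S (support p β) ≡ ∑ (map (λ a → monomial S a ∧ value p a) β)
moment-support S p [] = refl
moment-support S p (a ∷ β) with value p a
... | true  = cong₂ _xor_ (sym (∧-identityʳ (monomial S a))) (moment-support S p β)
... | false = trans (moment-support S p β)
  (cong (_xor ∑ (map (λ a → monomial S a ∧ value p a) β)) (sym (∧-zeroʳ (monomial S a))))

∑-cong : ∀ {A : Set} {f g : A → 𝔽₂} → (∀ x → f x ≡ g x) → ∀ xs → ∑ (map f xs) ≡ ∑ (map g xs)
∑-cong f≗g []       = refl
∑-cong f≗g (x ∷ xs) = cong₂ _xor_ (f≗g x) (∑-cong f≗g xs)

∈⇒1≤length : ∀ {A : Set} {x : A} {xs} → x ∈ xs → 1 ≤ length xs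
∈⇒1≤length {xs = _ ∷ _} _ = s≤s z≤n

-- The multipliers of degree at most `e` are those of degree below `suc e`, so `distance` applies
-- with `suc e` to the support, which contains `a`.
nonzero⇒large : ∀ {m} e {B : RawSystem m} {p} {β : List (Vec 𝔽₂ m)} {a} → Unique β →
        (∀ {q} → q ∈ multiples e B → ∑ (map (value q) β) ≡ false) →
        p ∈ B → a ∈ β → value p a ≡ true → 2 ^ suc e ≤ length β
nonzero⇒large e {B} {p} {β} unique sat p∈ a∈ pa≡1 = ≤-trans
  (distance (suc e) (support p β) (Unique.filter⁺ P? unique) (∈⇒1≤length (∈-filter⁺ P? a∈ pa≡1)) orth)
  (length-filter P? β)
  where
  P? = λ a → value p a ≟ᵇ true
  orth : ∀ S → ∣ S ∣ < suc e → moment S (support p β) ≡ false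
  orth S (s≤s S≤e) =
    let (q , q∈ , q≡) = multiples-complete e S S≤e p∈
    in trans (moment-support S p β) (trans (∑-cong (λ a → sym (q≡ a)) β) (sat q∈))

-- Typed systems

-- Restores the degree bound that raw polynomials lack. Excluding the constant monomial altogether
-- is stronger than `ConstantFree`, which lets it cancel, and survives multiplication monomial by
-- monomial.
Admissible : ∀ {m} → ℕ → Subset m → Set
Admissible d S = 1 ≤ ∣ S ∣ × ∣ S ∣ ≤ d

typedPoly : ∀ {n d} {p : RawPoly (suc n)} → All (Admissible d) p → Poly n d
typedPoly = All.reduce λ {S} (_ , S≤d) → S , S≤d

typedSystem : ∀ {n d} {B : RawSystem (suc n)} → All (All (Admissible d)) B → System n d
typedSystem = All.reduce typedPoly

encode-typedPoly : ∀ {n d} {p : RawPoly (suc n)} (adm : All (Admissible d) p) →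
                   encodePoly (typedPoly adm) ≡ encodeRawPoly p
encode-typedPoly []              = refl
encode-typedPoly {p = S ∷ _} (_ ∷ adm) = cong (encodeBits S ∙_) (encode-typedPoly adm)

encode-typedSystem : ∀ {n d} {B : RawSystem (suc n)} (adm : All (All (Admissible d)) B) →
                     encodeSystem (typedSystem adm) ≡ encodeRawSystem B
encode-typedSystem []             = refl
encode-typedSystem (p-adm ∷ adm) = cong₂ _∙_ (encode-typedPoly p-adm) (encode-typedSystem adm)

eval-typedPoly : ∀ {n d} {p : RawPoly (suc n)} (adm : All (Admissible d) p) a →
                 eval (typedPoly adm) a ≡ value p a
eval-typedPoly []                        a = refl
eval-typedPoly {p = S ∷ _} (_ ∷ adm) a = cong (monomial S a xor_) (eval-typedPoly adm a)

constantFree-typedPoly : ∀ {n d} {p : RawPoly (suc n)} (adm : All (Admissible d) p) →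
                         ConstantFree (typedPoly adm)
constantFree-typedPoly [] = refl
constantFree-typedPoly {n} {p = S ∷ _} ((1≤S , _) ∷ adm) with ≡-dec _≟ᵇ_ S ∅
... | yes refl = contradiction (≤-trans 1≤S (≤-reflexive (∣∅∣≡0 (suc n)))) λ ()
... | no _     = constantFree-typedPoly adm

All-typedSystem⁺ : ∀ {n d} {P : Poly n d → Set} {Q : RawPoly (suc n) → Set} {B} →
  (∀ {p} (adm : All (Admissible d) p) → Q p → P (typedPoly adm)) →
  (adm : All (All (Admissible d)) B) → All Q B → All P (typedSystem adm)
All-typedSystem⁺ f []            []       = []
All-typedSystem⁺ f (p-adm ∷ adm) (q ∷ qs) = f p-adm q ∷ All-typedSystem⁺ f adm qs

All-typedSystem⁻ : ∀ {n d} {P : Poly n d → Set} {Q : RawPoly (suc n) → Set} {B} →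
  (∀ {p} (adm : All (Admissible d) p) → P (typedPoly adm) → Q p) →
  (adm : All (All (Admissible d)) B) → All P (typedSystem adm) → All Q B
All-typedSystem⁻ f []            []       = []
All-typedSystem⁻ f (p-adm ∷ adm) (p ∷ ps) = f p-adm p ∷ All-typedSystem⁻ f adm ps

∣setBit∣≥1 : ∀ {m} (i : Fin m) S → 1 ≤ ∣ S [ i ]≔ true ∣
∣setBit∣≥1 zero    (b     ∷ S) = s≤s z≤n
∣setBit∣≥1 (suc i) (true  ∷ S) = s≤s z≤n
∣setBit∣≥1 (suc i) (false ∷ S) = ∣setBit∣≥1 i S

∣setBit∣≤ : ∀ {m} (i : Fin m) S → ∣ S [ i ]≔ true ∣ ≤ suc ∣ S ∣
∣setBit∣≤ zero    (true  ∷ S) = n≤1+n _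
∣setBit∣≤ zero    (false ∷ S) = ≤-refl
∣setBit∣≤ (suc i) (true  ∷ S) = s≤s (∣setBit∣≤ i S)
∣setBit∣≤ (suc i) (false ∷ S) = ∣setBit∣≤ i S

setBit-admissible : ∀ {m d} (i : Fin m) {S} → ∣ S ∣ ≤ d → Admissible (suc d) (S [ i ]≔ true)
setBit-admissible i {S} S≤d = ∣setBit∣≥1 i S , ≤-trans (∣setBit∣≤ i S) (s≤s S≤d)

weaken : ∀ {m j k} {S : Subset m} → j ≤ k → Admissible j S → Admissible k S
weaken j≤k (1≤S , S≤j) = 1≤S , ≤-trans S≤j j≤k

times-admissible : ∀ {m d} (i : Fin m) {p} → All (λ S → ∣ S ∣ ≤ d) p → All (Admissible (suc d)) (times i p)
times-admissible i p≤ = All-mapʳ++ (λ {S} → setBit-admissible i {S}) p≤ []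

timesFalsity-admissible : ∀ {n d} (l : Literal n) {p} → All (Admissible d) p →
                          All (Admissible (suc d)) (timesFalsity l p)
timesFalsity-admissible (false , i) adm = times-admissible (suc i) (All.map proj₂ adm)
timesFalsity-admissible (true  , i) adm =
  All-mapʳ++ (λ {S} → setBit-admissible (suc i) {S}) (All.map proj₂ adm)
             (All.map (λ {S} → weaken {S = S} (n≤1+n _)) adm)

x₀-≤1 : ∀ n → ∣ x₀ {n} ∣ ≤ 1
x₀-≤1 n = s≤s (≤-reflexive (∣∅∣≡0 n))

-- Three literals and `x₀` give degree 4, whence `4 ≤ d`. Starting from `x₀` keeps the constant
-- monomial out of the factors for positive literals.
clausePoly-admissible : ∀ {n} (C : Clause n) → All (Admissible 4) (clausePoly C)
clausePoly-admissible {n} (k ∷ l ∷ m ∷ []) =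
  timesFalsity-admissible m (timesFalsity-admissible l (timesFalsity-admissible k
    ((s≤s z≤n , x₀-≤1 n) ∷ [])))

baseSystem-admissible : ∀ {n} (φ : 3CNF n) → All (All (Admissible 4)) (baseSystem φ)
-- As `1 + x₀` contains the constant monomial, only degree at most 1 is asked of it; its products
-- with the variables have degree at most 2 and no constant monomial.
baseSystem-admissible {n} φ = All-expand {P = All (λ S → ∣ S ∣ ≤ 1)}
  (λ i p≤ → All.map (λ {S} → weaken {S = S} (s≤s (s≤s z≤n))) (times-admissible i p≤)) ≤-refl
  ((∣∅∣≤ (suc n) ∷ x₀-≤1 n ∷ []) ∷ [])
  (All-mapʳ++ {P = λ _ → ⊤} (λ {C} _ → clausePoly-admissible C) (All.universal _ (clauses φ)) [])

multiples-admissible : ∀ {n} e (φ : 3CNF n) → All (All (Admissible (e + 4))) (multiples e (baseSystem φ))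
multiples-admissible e φ = All-multiples {P = λ d → All (Admissible d)}
  (λ i adm → times-admissible i (All.map proj₂ adm)) (All.map λ {S} → weaken {S = S} (n≤1+n _))
  e (baseSystem-admissible φ)

-- Satisfying assignments

falsity-true : ∀ {n} {v : Vec Bool n} (l : Literal n) → LiteralTrue v l → falsity l v ≡ false
falsity-true (b , i) refl = xor-same b

falsity-false : ∀ {n} {v : Vec Bool n} (l : Literal n) → falsity l v ≡ false → LiteralTrue v l
falsity-false {v = v} (b , i) eq = xor≡false (lookup v i) b eq
  where
  xor≡false : ∀ x y → x xor y ≡ false → x ≡ y
  xor≡false false y     eq = sym eq
  xor≡false true  true  eq = refl

clausePoly-true : ∀ {n} {v : Vec Bool n} c C → VecAny.Any (LiteralTrue v) C →
                  value (clausePoly C) (c ∷ v) ≡ false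
clausePoly-true {v = v} c (k ∷ l ∷ m ∷ []) sat = trans (value-clausePoly k l m c v) (product≡0 sat)
  where
  product≡0 : VecAny.Any (LiteralTrue v) (k ∷ l ∷ m ∷ []) →
              falsity m v ∧ (falsity l v ∧ (falsity k v ∧ c)) ≡ false
  product≡0 (here k≡) rewrite falsity-true {v = v} k k≡ | ∧-zeroʳ (falsity l v) = ∧-zeroʳ (falsity m v)
  product≡0 (there (here l≡)) rewrite falsity-true {v = v} l l≡ = ∧-zeroʳ (falsity m v)
  product≡0 (there (there (here m≡))) rewrite falsity-true {v = v} m m≡ = refl

clausePoly-false : ∀ {n} {v : Vec Bool n} C → value (clausePoly C) (true ∷ v) ≡ false →
                   VecAny.Any (LiteralTrue v) C
clausePoly-false {v = v} (k ∷ l ∷ m ∷ []) eq with falsity m v in m≡ | falsity l v in l≡ | falsity k v in k≡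
... | false | _     | _     = there (there (here (falsity-false {v = v} m m≡)))
... | true  | false | _     = there (here (falsity-false {v = v} l l≡))
... | true  | true  | false = here (falsity-false {v = v} k k≡)
... | true  | true  | true  with () ← trans (sym (trans (value-clausePoly k l m true v)
  (cong₂ _∧_ m≡ (cong₂ _∧_ l≡ (cong (_∧ true) k≡))))) eq

Zero : ∀ {m} → Vec 𝔽₂ m → RawPoly m → Set
Zero a p = value p a ≡ false

times-zero : ∀ {m} {a : Vec 𝔽₂ m} i {p} → Zero a p → Zero a (times i p)
times-zero {a = a} i {p} p≡0 = trans (value-times i p a) (trans (cong (lookup a i ∧_) p≡0) (∧-zeroʳ _))

multiples-zero : ∀ {n} e {φ : 3CNF n} {v} → All (λ C → VecAny.Any (LiteralTrue v) C) (clauses φ) →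
                 All (Zero (true ∷ v)) (multiples e (baseSystem φ))
multiples-zero e {φ} {v} sat = All-multiples {P = λ _ → Zero (true ∷ v)}
  (λ i {_} {p} → times-zero {a = true ∷ v} i {p}) (λ p≡0 → p≡0) e {0}
  (All-expand {P = Zero (true ∷ v)} (λ i {p} → times-zero {a = true ∷ v} i {p}) ≤-refl
    (value-1+x₀ true v ∷ []) (All-mapʳ++ (λ {C} → clausePoly-true true C) sat []))

zero-vector : ∀ {m} (a : Vec 𝔽₂ m) → (∀ i → lookup a i ≡ false) → a ≡ replicate m false
zero-vector []      a≡0 = refl
zero-vector (b ∷ a) a≡0 = cong₂ _∷_ (a≡0 zero) (zero-vector a (a≡0 ∘ suc))

baseSystem-zero : ∀ {n} (φ : 3CNF n) → ¬ Satisfiable φ → ∀ a →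
                  (∀ {p} → p ∈ baseSystem φ → Zero a p) → a ≡ replicate _ false
baseSystem-zero φ unsat (true ∷ v) zeros = contradiction
  (v , All.tabulate λ {C} C∈ → clausePoly-false C
    (zeros (⊆-expand ≤-refl {(∅ ∷ x₀ ∷ []) ∷ []} (∈-mapʳ++⁺ˡ clausePoly C∈)))) unsat
-- At `x₀ = 0` the product of `1 + x₀` with the variable `i` takes the value `lookup a i`, so every
-- coordinate vanishes.
baseSystem-zero φ unsat a@(false ∷ v) zeros = zero-vector a λ i →
  trans (sym (trans (value-times i (∅ ∷ x₀ ∷ []) a)
                    (trans (cong (lookup a i ∧_) (value-1+x₀ false v)) (∧-identityʳ _))))
        (zeros (times∈expand ≤-refl {(∅ ∷ x₀ ∷ []) ∷ []} i (toℕ<n i) (here refl)))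

-- The two cases of the reduction

extendMonomial-∅ : ∀ {n d} (σ : MonomialAssignment n d) ∅≤d → extendMonomial σ (∅ , ∅≤d) ≡ true
extendMonomial-∅ {n} σ ∅≤d with 1 ≤? ∣ ∅ {suc n} ∣
... | yes 1≤ = contradiction (≤-trans 1≤ (≤-reflexive (∣∅∣≡0 (suc n)))) λ ()
... | no  _  = refl

-- Tested on the constant polynomial 1, whose value under `σ` is 1 while the empty sum is 0.
¬Represents-[] : ∀ {n d} (σ : MonomialAssignment n d) → ¬ Represents σ []
¬Represents-[] {n} σ (_ , rep) = contradiction
  (trans (sym (cong (_xor false) (extendMonomial-∅ σ (∣∅∣≤ (suc n))))) (rep ((∅ , ∣∅∣≤ (suc n)) ∷ []))) λ ()

Unique-constant : ∀ {A : Set} {x : A} {xs} → Unique xs → xs ≢ [] → (∀ {y} → y ∈ xs → y ≡ x) → xs ≡ x ∷ []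
Unique-constant {xs = []}         _                xs≢[] _  = contradiction refl xs≢[]
Unique-constant {xs = _ ∷ []}     _                _    ≡x = cong (_∷ []) (≡x (here refl))
Unique-constant {xs = _ ∷ _ ∷ _} ((y≢z ∷ _) ∷ _) _    ≡x =
  contradiction (trans (≡x (here refl)) (sym (≡x (there (here refl))))) y≢z

reducedSystem : ∀ {n} e → 3CNF n → System n (e + 4)
reducedSystem e φ = typedSystem (multiples-admissible e φ)

reducedSystem-solved : ∀ {n} e {φ : 3CNF n} {v} →
  All (λ C → VecAny.Any (LiteralTrue v) C) (clauses φ) → Solves (true ∷ v) (reducedSystem e φ)
reducedSystem-solved e {φ} {v} sat = All-typedSystem⁺ {Q = Zero (true ∷ v)}
  (λ adm p≡0 → trans (eval-typedPoly adm (true ∷ v)) p≡0)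
  (multiples-admissible e φ) (multiples-zero e {φ} sat)

reducedSystem-unsat : ∀ {n} e {φ : 3CNF n} → ¬ Satisfiable φ →
  ∀ (σ : MonomialAssignment n (e + 4)) → SatisfiesAll σ (reducedSystem e φ) → ∀ β → Represents σ β →
  β ≡ replicate _ false ∷ [] ⊎ 2 ^ suc e ≤ length β
reducedSystem-unsat e {φ} unsat σ sat β rep@(unique , σ≡∑β)
  -- A finite search for a point of `β` at which some base polynomial takes the value 1.
  with any? (λ a → any? (λ p → value p a ≟ᵇ true) (baseSystem φ)) β
... | yes any = let (a , a∈ , any′) = find any
                    (p , p∈ , pa≡1) = find any′
                in inj₂ (nonzero⇒large e unique orth p∈ a∈ pa≡1)
  where
  orth : ∀ {q} → q ∈ multiples e (baseSystem φ) → ∑ (map (value q) β) ≡ false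
  -- Since `β` represents `σ`, each equation that `σ` satisfies says that the polynomial sums to 0
  -- over `β`.
  orth = All.lookup (All-typedSystem⁻
    (λ adm σp≡0 → trans (∑-cong (λ a → sym (eval-typedPoly adm a)) β)
                        (trans (sym (σ≡∑β (typedPoly adm))) σp≡0))
    (multiples-admissible e φ) sat)
-- All base polynomials vanish on `β`, so each of its points is the zero vector; being non-empty and
-- duplicate-free, `β` is that singleton.
... | no ¬any = inj₁ (Unique-constant unique (λ { refl → ¬Represents-[] σ rep }) λ {a} a∈ →
  baseSystem-zero φ unsat a λ p∈ → ¬-not λ pa≡1 → ¬any (lose a∈ (lose p∈ pa≡1)))

-- Assembly of the reduction

Reduction : ℕ → ℕ → Set
Reduction c d =
    Σ[ reduction ∈ Program ] (∀ (n : ℕ) (φ : 3CNF n) →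
    Σ[ B ∈ System n d ]
    ( (Σ[ t ∈ ℕ ]
    ( reduction ∶ encode3CNF φ ⇓ encodeSystem B [ t ]
    × t ≤ (2 + n) ^ (c * d) ))
    × All ConstantFree B
    × (Satisfiable φ →
    Σ[ a ∈ Point n ] (Solves a B × lookup a zero ≡ true))
    × (¬ Satisfiable φ →
    ∀ (σ : MonomialAssignment n d) → SatisfiesAll σ B →
    ∀ (β : List (Point n)) → IsMinimumRepresentation σ β →
    (β ≡ replicate _ false ∷ [] ⊎ 2 ^ (d ∸ 3) ≤ length β)) ))

reduction : ∀ e → Reduction degreeFactor (e + 4)
reduction e = rounds e ⨾ tail , λ n φ →
  reducedSystem e φ ,
  Halts-cong (reduction-runs e φ) (sym (encode-typedSystem (multiples-admissible e φ))) ,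
  All-typedSystem⁺ (λ adm _ → constantFree-typedPoly adm) (multiples-admissible e φ)
    (All.universal (λ _ → tt) _) ,
  (λ (v , sat) → true ∷ v , reducedSystem-solved e {φ} sat , refl) ,
  λ unsat σ sat β (rep , _) →
    -- The exponent `suc e` equals `(e + 4) ∸ 3`.
    subst (λ k → β ≡ replicate _ false ∷ [] ⊎ 2 ^ k ≤ length β)
          (sym (trans (+-∸-assoc e {4} {3} (s≤s (s≤s (s≤s z≤n)))) (+-comm e 1)))
          (reducedSystem-unsat e {φ} unsat σ sat β rep)

theorem3p4 : Σ[ c ∈ ℕ ] (∀ (d : ℕ) → 4 ≤ d →
    Σ[ reduction ∈ Program ] (∀ (n : ℕ) (φ : 3CNF n) →
    Σ[ B ∈ System n d ]
    ( (Σ[ t ∈ ℕ ]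
    ( reduction ∶ encode3CNF φ ⇓ encodeSystem B [ t ]
    × t ≤ (2 + n) ^ (c * d) ))
    × All ConstantFree B
    × (Satisfiable φ →
    Σ[ a ∈ Point n ] (Solves a B × lookup a zero ≡ true))
    × (¬ Satisfiable φ →
    ∀ (σ : MonomialAssignment n d) → SatisfiesAll σ B →
    ∀ (β : List (Point n)) → IsMinimumRepresentation σ β →
    (β ≡ replicate _ false ∷ [] ⊎ 2 ^ (d ∸ 3) ≤ length β)) )))
theorem3p4 = degreeFactor , λ d 4≤d →
  -- The `d ∸ 4` rounds raise the degree bound from 4 to `d`; by `4 ≤ d` the truncated subtraction
  -- is exact.
  subst (Reduction degreeFactor) (m∸n+n≡m 4≤d) (reduction (d ∸ 4))
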